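{- For every integer $d \ge 1$ there is a finite graph $G$ (regarded as a simplicial complex) such that, for every integer $1\le d' \le d$, $G$ is neither weakly $d'$-Tverberg nor $d'$-Tverberg.
   Context: A simplicial complex on vertex set $[n]=\{1,\dots,n\}$ is a downward-closed family $\Delta\subseteq 2^{[n]}$; a graph is regarded as the simplicial complex consisting of the empty set, its vertices (as singletons) and its edges. A finite set $P\subseteq\mathbb{R}^d$ is in general position if for every $k\le d+1$ no $k$ points of $P$ lie on a common $(k-2)$-dimensional affine subspace. A complex $\Delta\subseteq 2^{[n]}$ is partition induced on a finite set $P\subseteq \mathbb{R}^d$ if there is a partition $\{P_1,\dots,P_n\}$ of $P$ such that for every $\sigma\subseteq[n]$, $\bigcap_{i\in\sigma}\mathrm{conv}(P_i)\neq\emptyset$ iff $\sigma\in\Delta$ (i.e. $\Delta$ is the nerve of $\{\mathrm{conv}(P_1),\dots,\mathrm{conv}(P_n)\}$). $\Delta$ is $d$-Tverberg if there is a constant $C$ such that $\Delta$ is partition induced on every point set $P\subseteq\mathbb{R}^d$ in general position with at least $C$ points. $\Delta$ is weakly $d$-Tverberg if there is a constant $C$ such that for every point set $P\subseteq\mathbb{R}^d$ in general position with at least $C$ points, $\Delta$ is partition induced on some subset of $P$. -}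

module Defs where

open import Level using (Level; 0ℓ) renaming (suc to lsuc; _⊔_ to _⊔ˡ_)
open import Data.Nat using (ℕ; zero; suc; _≤_; _∸_)
open import Data.Fin using (Fin; zero; suc)
open import Data.Fin.Subset using (Subset; _∈_; ⁅_⁆; _∪_; ∣_∣)
open import Data.Product using (Σ; ∃; ∃₂; _×_; _,_)
open import Data.Sum using (_⊎_)
open import Relation.Nullary using (¬_)
open import Relation.Binary.PropositionalEquality using (_≡_)
open import Relation.Binary.Structures using (IsTotalOrder)
open import Algebra.Bundles using (CommutativeRing)
open import Function.Definitions using (Injective)

-- Complete ordered fields (the real numbers, axiomatised up to
-- isomorphism: every Dedekind-complete ordered field is isomorphic to ℝ).

record CompleteOrderedField c ℓ₁ ℓ₂ : Set (lsuc (c ⊔ˡ ℓ₁ ⊔ˡ ℓ₂)) where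
  field
    commutativeRing : CommutativeRing c ℓ₁
  open CommutativeRing commutativeRing public
  field
    _≤F_          : Carrier → Carrier → Set ℓ₂
    ≤-isTotalOrder : IsTotalOrder _≈_ _≤F_
    0≉1           : ¬ (0# ≈ 1#)
    inverse       : ∀ x → ¬ (x ≈ 0#) → ∃ λ y → x * y ≈ 1#
    +-mono-≤      : ∀ {x y} z → x ≤F y → (x + z) ≤F (y + z)
    *-nonneg      : ∀ {x y} → 0# ≤F x → 0# ≤F y → 0# ≤F (x * y)
    complete      : (S : Carrier → Set (c ⊔ˡ ℓ₁ ⊔ˡ ℓ₂)) →
                    (∃ λ x → S x) →
                    (∃ λ b → ∀ x → S x → x ≤F b) →
                    ∃ λ s → (∀ x → S x → x ≤F s) ×
                            (∀ b → (∀ x → S x → x ≤F b) → s ≤F b)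

Complex : ℕ → Set₁
Complex n = Subset n → Set

record Graph (n : ℕ) : Set₁ where
  field
    Adj     : Fin n → Fin n → Set
    sym     : ∀ {u v} → Adj u v → Adj v u
    irrefl  : ∀ {u} → ¬ Adj u u

graphComplex : ∀ {n} → Graph n → Complex n
graphComplex {n} G σ =
  (∣ σ ∣ ≤ 1) ⊎ (∃₂ λ u v → Graph.Adj G u v × σ ≡ (⁅ u ⁆ ∪ ⁅ v ⁆))

module Geometry {c ℓ₁ ℓ₂} (F : CompleteOrderedField c ℓ₁ ℓ₂) where
  open CompleteOrderedField F using (Carrier; _≈_; _+_; _*_; 0#; 1#; _≤F_)

  Point : ℕ → Set c
  Point d = Fin d → Carrier

  ∑ : ∀ {m} → (Fin m → Carrier) → Carrier
  ∑ {zero}  f = 0#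
  ∑ {suc m} f = f zero + ∑ (λ j → f (suc j))

  InConv : ∀ {d m n} → (Fin m → Point d) → (Fin m → Fin n) → Fin n →
           Point d → Set (c ⊔ˡ ℓ₁ ⊔ˡ ℓ₂)
  InConv {d} {m} P f i x =
    ∃ λ (w : Fin m → Carrier) →
      (∀ j → 0# ≤F w j) ×
      (∀ j → ¬ (f j ≡ i) → w j ≈ 0#) ×
      (∑ w ≈ 1#) ×
      (∀ (t : Fin d) → ∑ (λ j → w j * P j t) ≈ x t)

  CommonPoint : ∀ {d m n} → (Fin m → Point d) → (Fin m → Fin n) →
                Subset n → Set (c ⊔ˡ ℓ₁ ⊔ˡ ℓ₂)
  CommonPoint {d} P f σ = ∃ λ (x : Point d) → ∀ i → i ∈ σ → InConv P f i x

  OnAffine : ∀ {d k} → ℕ → (Fin k → Point d) → Set (c ⊔ˡ ℓ₁)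
  OnAffine {d} r q =
    ∃ λ (a : Point d) → ∃ λ (v : Fin r → Point d) →
      ∀ t → ∃ λ (co : Fin r → Carrier) →
        ∀ (s : Fin d) → q t s ≈ (a s + ∑ (λ l → co l * v l s))

  -- general position: for every 2 ≤ k ≤ d+1, no k (distinct) points of P
  -- lie on a common (k-2)-dimensional affine subspace (k = 1 is vacuous).
  GeneralPosition : ∀ {d m} → (Fin m → Point d) → Set (c ⊔ˡ ℓ₁)
  GeneralPosition {d} {m} P =
    ∀ k → 2 ≤ k → k ≤ suc d → (g : Fin k → Fin m) → Injective _≡_ _≡_ g →
      ¬ OnAffine (k ∸ 2) (λ t → P (g t))

  -- Δ is partition induced on P: there is a partition of P into n parts
  -- (given by a labelling f; parts are nonempty whenever all singletons
  -- are faces) whose convex hulls have nerve Δ.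
  PartitionInduced : ∀ {d m n} → Complex n → (Fin m → Point d) →
                     Set (c ⊔ˡ ℓ₁ ⊔ˡ ℓ₂)
  PartitionInduced {d} {m} {n} Δ P =
    ∃ λ (f : Fin m → Fin n) →
      ∀ σ → (CommonPoint P f σ → Δ σ) × (Δ σ → CommonPoint P f σ)

  Tverberg : ∀ {n} → ℕ → Complex n → Set (c ⊔ˡ ℓ₁ ⊔ˡ ℓ₂)
  Tverberg d Δ =
    ∃ λ (C : ℕ) → ∀ m (P : Fin m → Point d) → GeneralPosition P → C ≤ m →
      PartitionInduced Δ P

  WeaklyTverberg : ∀ {n} → ℕ → Complex n → Set (c ⊔ˡ ℓ₁ ⊔ˡ ℓ₂)
  WeaklyTverberg d Δ =
    ∃ λ (C : ℕ) → ∀ m (P : Fin m → Point d) → GeneralPosition P → C ≤ m →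
      ∃ λ m' → ∃ λ (h : Fin m' → Fin m) → Injective _≡_ _≡_ h ×
        PartitionInduced Δ (λ j → P (h j))

{-# OPTIONS --safe #-}
module Submission where

open import Defs
open import Level using (0ℓ)
open import Data.Bool using (Bool; true; false; not; if_then_else_)
open import Data.Bool.Properties using (not-¬)
open import Data.Empty using (⊥; ⊥-elim)
open import Data.Fin as Fin
  using (Fin; zero; suc; toℕ; fromℕ<; punchIn; punchOut; combine; quotient; finToFun; funToFin; splitAt; join)
import Data.Fin.Properties as Fin
open import Data.Fin.Subset as Subset using (⁅_⁆; _∪_; ∣_∣)
open import Data.Fin.Subset.Properties
  using (x∈⁅x⁆; x∈⁅y⁆⇒x≡y; x∈p∪q⁻; x∈p∪q⁺; p⊆p∪q; p⊂q⇒∣p∣<∣q∣; ∣⁅x⁆∣≡1)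
open import Data.List as List using (List; []; _∷_; length)
import Data.List.Properties as List
open import Data.List.Membership.Propositional using (_∈_)
open import Data.List.Membership.Propositional.Properties using (∈-tabulate⁺)
open import Data.List.Relation.Unary.All as All using (All; []; _∷_)
import Data.List.Relation.Unary.All.Properties as All
open import Data.List.Relation.Unary.Any using (here; there; index)
open import Data.List.Relation.Unary.Any.Properties using (lookup-index)
open import Data.Nat as ℕ using (ℕ; zero; suc; _≤_; _<_; z≤n; s≤s)
import Data.Nat.Properties as ℕ
open import Data.Nat.Tactic.RingSolver using (solve-∀)
open import Data.Product using (∃; _×_; _,_; proj₁; proj₂)
open import Data.Sum as Sum using (_⊎_; inj₁; inj₂)
open import Data.Sum.Properties using (inj₁-injective; inj₂-injective)
open import Data.Vec as Vec using (Vec; []; _∷_)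
import Data.Vec.Properties as Vec
open import Function using (_∘_; id; const)
open import Relation.Binary.Definitions using (tri<; tri≈; tri>)
open import Relation.Binary.PropositionalEquality as ≡ using (_≡_; _≢_)
open import Relation.Binary.Structures using (IsTotalOrder)
open import Relation.Nullary using (¬_; yes; no; contradiction)
open import Relation.Nullary.Decidable using (_×-dec_)
open import Relation.Unary using (Decidable)

-- Take points on the moment curve.  Read along the curve, a labelling of them is a word, and the hulls of
-- two classes u and v meet in ℝᵈ iff the word contains an alternating subsequence u v u v … of length d + 2:
-- divided differences provide the Radon partition, and a polynomial of degree ≤ d with a root at each
-- change of letter separates the classes otherwise.
--
-- Let G be bipartite, with parts A = [n] × [D], D = d + 2, and B = 2^[n], where (x , i) is joined to b iff
-- x ∈ b.  The letters of A pairwise alternate fewer than D times, so polynomially many (in n) cuts divide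
-- the word into intervals each containing at most one letter of A.  Two letters of B cannot both visit
-- d + 2 common intervals.  If b visits fewer, then for each x some copy (x , i) has no interval visited
-- by b, and whether that copy alternates with b only depends on the set of intervals visited.  Hence b is
-- determined by the first d + 2 intervals it visits, which is impossible once 2^n is large.

-- Alternation in words

module Alternation where

  open import Data.Nat using (_+_; _*_; _^_; pred; _≟_; _≤?_)
  open import Data.Nat.Properties
  open ≡ using (refl; sym; trans; cong; cong₂; subst; _≗_; module ≡-Reasoning)

  -- `p` bounds the remaining positions from below. Passing on `suc q` makes the chain strictly
  -- increasing, and exchanging `X` and `Y` makes it alternate.
  data Alt (X Y : ℕ → Set) : ℕ → ℕ → Set where
    []   : ∀ {p} → Alt X Y 0 p
    step : ∀ {k p q} → p ≤ q → X q → Alt Y X k (suc q) → Alt X Y (suc k) p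

  Alternating : ℕ → (X Y : ℕ → Set) → Set
  Alternating k X Y = Alt X Y k 0 ⊎ Alt Y X k 0

  Disjoint : (X Y : ℕ → Set) → Set
  Disjoint X Y = ∀ {q} → X q → Y q → ⊥

  Bounded : ℕ → (ℕ → Set) → Set
  Bounded m X = ∀ {q} → X q → q < m

  First : (ℕ → Set) → ℕ → Set
  First X p = ∃ λ q → p ≤ q × X q × (∀ {r} → p ≤ r → r < q → ¬ X r)

  first : ∀ {X m} → Decidable X → Bounded m X → ∀ p →
          First X p ⊎ (∀ {q} → p ≤ q → ¬ X q)
  first {X} {m} X? X<m p = search m p (m≤m+n m p)
    where
    search : ∀ fuel p → m ≤ fuel + p → First X p ⊎ (∀ {q} → p ≤ q → ¬ X q)
    search zero       p m≤p = inj₂ λ p≤q x → <⇒≱ (X<m x) (≤-trans m≤p p≤q)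
    search (suc fuel) p m≤p with X? p
    ... | yes x = inj₁ (p , ≤-refl , x , λ p≤r r<p _ → <⇒≱ r<p p≤r)
    ... | no ¬x with search fuel (suc p) (subst (m ≤_) (sym (+-suc fuel p)) m≤p)
    ...   | inj₁ (q , p<q , x , none) = inj₁ (q , <⇒≤ p<q , x , λ p≤r r<q →
              Sum.[ (λ p<r → none p<r r<q) , (λ { refl → ¬x }) ] (m≤n⇒m<n∨m≡n p≤r))
    ...   | inj₂ none = inj₂ λ p≤r →
              Sum.[ none , (λ { refl → ¬x }) ] (m≤n⇒m<n∨m≡n p≤r)

  -- Cutting a word to separate two letters

  -- The level sets of `rank cs` are the intervals into which the cuts divide the word, numbered
  -- from left to right.
  rank : List ℕ → ℕ → ℕ
  rank []       q = 0
  rank (c ∷ cs) q with c ≤? q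
  ... | yes _ = suc (rank cs q)
  ... | no _  = rank cs q

  rank-∷-≤ : ∀ {c q} cs → c ≤ q → rank (c ∷ cs) q ≡ suc (rank cs q)
  rank-∷-≤ {c} {q} cs c≤q with c ≤? q
  ... | yes _   = refl
  ... | no  c≰q = contradiction c≤q c≰q

  rank-∷-> : ∀ {c q} cs → q < c → rank (c ∷ cs) q ≡ rank cs q
  rank-∷-> {c} {q} cs q<c with c ≤? q
  ... | yes c≤q = contradiction c≤q (<⇒≱ q<c)
  ... | no  _   = refl

  rank-mono : ∀ cs {p q} → p ≤ q → rank cs p ≤ rank cs q
  rank-mono []       p≤q = z≤n
  rank-mono (c ∷ cs) {p} {q} p≤q with c ≤? p | c ≤? q
  ... | yes _   | yes _   = s≤s (rank-mono cs p≤q)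
  ... | yes c≤p | no  c≰q = contradiction (≤-trans c≤p p≤q) c≰q
  ... | no  _   | yes _   = m≤n⇒m≤1+n (rank-mono cs p≤q)
  ... | no  _   | no  _   = rank-mono cs p≤q

  rank≤length : ∀ cs q → rank cs q ≤ length cs
  rank≤length []       q = z≤n
  rank≤length (c ∷ cs) q with c ≤? q
  ... | yes _ = s≤s (rank≤length cs q)
  ... | no  _ = m≤n⇒m≤1+n (rank≤length cs q)

  rank≡0 : ∀ {cs p q} → All (p ≤_) cs → q < p → rank cs q ≡ 0
  rank≡0 []            q<p = refl
  rank≡0 {c ∷ cs} (p≤c ∷ ps) q<p = trans (rank-∷-> cs (<-≤-trans q<p p≤c)) (rank≡0 ps q<p)

  odd : ℕ → Bool
  odd zero    = false
  odd (suc n) = not (odd n)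

  -- Greedy cutting: a cut is placed at the first `X` from `p` on, and the search continues behind
  -- it with the letters exchanged. The cut positions themselves form an alternating chain, so
  -- `suc k` of them give the first alternative.
  cuts : ∀ {X Y m} → Decidable X → Decidable Y → Bounded m X → Bounded m Y → Disjoint X Y →
         ∀ k p → Alt X Y (suc k) p ⊎ ∃ λ cs → length cs ≤ k × All (p ≤_) cs ×
           (∀ {q} → p ≤ q → X q → odd (rank cs q) ≡ true) ×
           (∀ {q} → p ≤ q → Y q → odd (rank cs q) ≡ false)
  cuts {X} {Y} X? Y? X<m Y<m dis k p with first X? X<m p
  ... | inj₂ none = inj₂ ([] , z≤n , [] , (λ p≤q x → contradiction x (none p≤q)) , λ _ _ → refl)
  cuts X? Y? X<m Y<m dis zero p | inj₁ (q , p≤q , x , none) = inj₁ (step p≤q x [])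
  cuts {X} {Y} X? Y? X<m Y<m dis (suc k) p | inj₁ (q , p≤q , x , none)
    with cuts Y? X? Y<m X<m (λ y x → dis x y) k (suc q)
  ... | inj₁ alt = inj₁ (step p≤q x alt)
  ... | inj₂ (cs , len , q<cs , oddY , evenX) =
    inj₂ (q ∷ cs , s≤s len , p≤q ∷ All.map (≤-trans (≤-trans p≤q (n≤1+n q))) q<cs , oddX′ , evenY′)
    where
    oddX′ : ∀ {r} → p ≤ r → X r → odd (rank (q ∷ cs) r) ≡ true
    oddX′ {r} p≤r x′ with <-cmp r q
    ... | tri< r<q _ _  = contradiction x′ (none p≤r r<q)
    ... | tri≈ _ refl _ rewrite rank-∷-≤ cs (≤-refl {q}) | rank≡0 q<cs (n<1+n q) = refl
    ... | tri> _ _ q<r rewrite rank-∷-≤ cs (<⇒≤ q<r) | evenX q<r x′ = refl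
    evenY′ : ∀ {r} → p ≤ r → Y r → odd (rank (q ∷ cs) r) ≡ false
    evenY′ {r} p≤r y′ with <-cmp r q
    ... | tri< r<q _ _  rewrite rank-∷-> cs r<q | rank≡0 q<cs (m<n⇒m<1+n r<q) = refl
    ... | tri≈ _ refl _ = ⊥-elim (dis x y′)
    ... | tri> _ _ q<r rewrite rank-∷-≤ cs (<⇒≤ q<r) | oddY q<r y′ = refl

  -- The first letter of the chain that begins earlier can be put in front of the other chain.
  Alt-extend : ∀ {X Y k} → Disjoint X Y →
               Alt X Y (suc k) 0 → Alt Y X (suc k) 0 → Alternating (suc (suc k)) X Y
  Alt-extend dis (step {q = q} p≤q x a) (step {q = r} p≤r y b) with <-cmp q r
  ... | tri< q<r _ _  = inj₁ (step p≤q x (step q<r y b))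
  ... | tri≈ _ refl _ = ⊥-elim (dis x y)
  ... | tri> _ _ r<q  = inj₂ (step p≤r y (step r<q x a))

  Separated : ℕ → (X Y : ℕ → Set) → Set
  Separated k X Y = ∃ λ cs → length cs ≤ k × ∃ λ b →
    (∀ {q} → X q → odd (rank cs q) ≡ b) × (∀ {q} → Y q → odd (rank cs q) ≡ not b)

  -- Greedy cutting is run from both letters. If `k` cuts suffice neither time, there are chains of
  -- length `suc k` starting with each letter, and `Alt-extend` gains one more.
  alternating⊎separated : ∀ {X Y m} → Decidable X → Decidable Y → Bounded m X → Bounded m Y →
    Disjoint X Y → ∀ k → Alternating (suc (suc k)) X Y ⊎ Separated k X Y
  alternating⊎separated X? Y? X<m Y<m dis k
    with cuts X? Y? X<m Y<m dis k 0
  ... | inj₂ (cs , len , _ , oddX , evenY) = inj₂ (cs , len , true , oddX z≤n , evenY z≤n)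
  ... | inj₁ a with cuts Y? X? Y<m X<m (λ y x → dis x y) k 0
  ...   | inj₂ (cs , len , _ , oddY , evenX) = inj₂ (cs , len , false , evenX z≤n , oddY z≤n)
  ...   | inj₁ b = inj₁ (Alt-extend dis a b)

  -- Interval indices as monotone maps

  Monotone : (ℕ → ℕ) → Set
  Monotone φ = ∀ {p q} → p ≤ q → φ p ≤ φ q

  +-≡-split : ∀ {a b c d} → a ≤ b → c ≤ d → a + c ≡ b + d → a ≡ b × c ≡ d
  +-≡-split {a} {b} {c} {d} a≤b c≤d eq =
    a≡b , +-cancelˡ-≡ b c d (subst (λ z → z + c ≡ b + d) a≡b eq)
    where
    a≡b : a ≡ b
    a≡b = ≤-antisym a≤b (+-cancelʳ-≤ d b a (≤-trans (≤-reflexive (sym eq)) (+-monoʳ-≤ a c≤d)))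

  -- The sum of the `φ i` works: all summands move in the same direction, so the sum can agree at
  -- two positions only if every summand does.
  commonRefinement : ∀ {n B} (φ : Fin n → ℕ → ℕ) → (∀ i → Monotone (φ i)) → (∀ i p → φ i p ≤ B) →
    ∃ λ ψ → Monotone ψ × (∀ p → ψ p ≤ n * B) × (∀ i {p q} → ψ p ≡ ψ q → φ i p ≡ φ i q)
  commonRefinement {zero}  φ mono bound = const 0 , (λ _ → z≤n) , (λ _ → z≤n) , λ ()
  commonRefinement {suc n} {B} φ mono bound with commonRefinement (φ ∘ suc) (mono ∘ suc) (bound ∘ suc)
  ... | ψ , ψ-mono , ψ-bound , ψ-fine = χ , χ-mono , (λ p → +-mono-≤ (bound zero p) (ψ-bound p)) , fine
    where
    χ : ℕ → ℕ
    χ p = φ zero p + ψ p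
    χ-mono : Monotone χ
    χ-mono p≤q = +-mono-≤ (mono zero p≤q) (ψ-mono p≤q)
    split : ∀ {p q} → χ p ≡ χ q → φ zero p ≡ φ zero q × ψ p ≡ ψ q
    split {p} {q} eq with ≤-total p q
    ... | inj₁ p≤q = +-≡-split (mono zero p≤q) (ψ-mono p≤q) eq
    ... | inj₂ q≤p with +-≡-split (mono zero q≤p) (ψ-mono q≤p) (sym eq)
    ...   | e , e′ = sym e , sym e′
    fine : ∀ i {p q} → χ p ≡ χ q → φ i p ≡ φ i q
    fine zero    = proj₁ ∘ split
    fine (suc i) = ψ-fine i ∘ proj₂ ∘ split

  -- For an interval index `φ`, the set of intervals that the letter `X` visits.
  Img : (ℕ → ℕ) → (ℕ → Set) → ℕ → Set
  Img φ X j = ∃ λ p → X p × φ p ≡ j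

  Img? : ∀ {φ X m} → Decidable X → Bounded m X → Decidable (Img φ X)
  Img? {φ} {X} {m} X? X<m j with anyUpTo? (λ p → X? p ×-dec (φ p ≟ j)) m
  ... | yes (p , _ , x , eq) = yes (p , x , eq)
  ... | no none              = no λ { (p , x , eq) → none (p , X<m x , x , eq) }

  module _ {φ : ℕ → ℕ} (mono : Monotone φ) where

    mono-reflects-< : ∀ {p q} → φ p < φ q → p < q
    mono-reflects-< {p} {q} φp<φq with q ≤? p
    ... | yes q≤p = contradiction (mono q≤p) (<⇒≱ φp<φq)
    ... | no  q≰p = ≰⇒> q≰p

    -- Consecutive terms of the chain carry different letters, which share no interval, so the
    -- weakly increasing indices increase strictly.
    Alt-Img : ∀ {X Y k p i} → Disjoint (Img φ X) (Img φ Y) →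
              (∀ {q} → p ≤ q → X q → i ≤ φ q) → Alt X Y k p → Alt (Img φ X) (Img φ Y) k i
    Alt-Img dis low [] = []
    Alt-Img {Y = Y} dis low (step {q = q} p≤q x a) =
      step (low p≤q x) (_ , x , refl) (Alt-Img (λ y x → dis x y) low′ a)
      where
      low′ : ∀ {r} → suc q ≤ r → Y r → suc (φ q) ≤ φ r
      low′ q<r y = ≤∧≢⇒< (mono (<⇒≤ q<r)) λ eq → dis (_ , x , eq) (_ , y , refl)

    -- A smaller index means an earlier position, so one visit chosen in each interval gives a chain
    -- of positions.
    Img-Alt : ∀ {X Y k p i} → (∀ {q} → i ≤ φ q → p ≤ q) →
              Alt (Img φ X) (Img φ Y) k i → Alt X Y k p
    Img-Alt low [] = []
    Img-Alt low (step i≤j (q , x , refl) a) =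
      step (low i≤j) x (Img-Alt mono-reflects-< a)

  Alt-map : ∀ {X X′ Y Y′ k p} → (∀ {q} → X q → X′ q) → (∀ {q} → Y q → Y′ q) →
            Alt X Y k p → Alt X′ Y′ k p
  Alt-map f g []             = []
  Alt-map f g (step p≤q x a) = step p≤q (f x) (Alt-map g f a)

  -- Codes of sets of intervals

  module _ {M : ℕ} where

    -- The first k elements of I from p on, padded with M ∉ I.
    code : ∀ {I} → Decidable I → Bounded M I → (k p : ℕ) → Vec ℕ k
    code I? I<M zero    p = []
    code I? I<M (suc k) p with first I? I<M p
    ... | inj₁ (q , _) = q ∷ code I? I<M k (suc q)
    ... | inj₂ _       = M ∷ code I? I<M k p

    code-≤ : ∀ {I} (I? : Decidable I) (I<M : Bounded M I) k p i → Vec.lookup (code I? I<M k p) i ≤ M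
    code-≤ I? I<M (suc k) p i with first I? I<M p
    code-≤ I? I<M (suc k) p zero    | inj₁ (q , _ , x , _) = <⇒≤ (I<M x)
    code-≤ I? I<M (suc k) p (suc i) | inj₁ (q , _)         = code-≤ I? I<M k (suc q) i
    code-≤ I? I<M (suc k) p zero    | inj₂ _               = ≤-refl
    code-≤ I? I<M (suc k) p (suc i) | inj₂ _               = code-≤ I? I<M k p i

    -- Every element listed by equal codes lies in both sets. A full list can be read alternately in
    -- `I` and `J`; a padding entry shows that both sets are exhausted, hence equal from `p` on.
    code-≡ : ∀ {I J} (I? : Decidable I) (J? : Decidable J) (I<M : Bounded M I) (J<M : Bounded M J) →
      ∀ k p → code I? I<M k p ≡ code J? J<M k p →
      Alt I J k p ⊎ ∃ λ js → length js < k ×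
        (∀ {j} → p ≤ j → I j → J j × j ∈ js) × (∀ {j} → p ≤ j → J j → I j × j ∈ js)
    code-≡ I? J? I<M J<M zero    p eq = inj₁ []
    code-≡ {I} {J} I? J? I<M J<M (suc k) p eq with first I? I<M p | first J? J<M p
    ... | inj₁ (q , _ , x , _) | inj₂ _ = contradiction (Vec.∷-injectiveˡ eq) (<⇒≢ (I<M x))
    ... | inj₂ _ | inj₁ (q , _ , x , _) = contradiction (sym (Vec.∷-injectiveˡ eq)) (<⇒≢ (J<M x))
    ... | inj₂ ¬I | inj₂ ¬J = inj₂ ([] , s≤s z≤n ,
            (λ p≤j x → contradiction x (¬I p≤j)) , (λ p≤j x → contradiction x (¬J p≤j)))
    ... | inj₁ (q , p≤q , x , ¬I) | inj₁ (q′ , _ , y , ¬J) with Vec.∷-injective eq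
    -- `I` and `J` change places here because `Alt` changes letters at each step.
    ...   | refl , eq′ with code-≡ J? I? J<M I<M k (suc q) (sym eq′)
    ...     | inj₁ alt = inj₁ (step p≤q x alt)
    ...     | inj₂ (js , len , J⊆ , I⊆) =
              inj₂ (q ∷ js , s≤s len , extend x y ¬I I⊆ , extend y x ¬J J⊆)
      where
      extend : ∀ {I J : ℕ → Set} → I q → J q → (∀ {r} → p ≤ r → r < q → ¬ I r) →
               (∀ {j} → suc q ≤ j → I j → J j × j ∈ js) →
               ∀ {j} → p ≤ j → I j → J j × j ∈ (q ∷ js)
      extend x y ¬I I⊆ {j} p≤j z with <-cmp j q
      ... | tri< j<q _ _  = contradiction z (¬I p≤j j<q)
      ... | tri≈ _ refl _ = y , here refl
      ... | tri> _ _ q<j with I⊆ q<j z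
      ...   | z′ , j∈js = z′ , there j∈js

  -- This permits classical reasoning about finitely many cases whenever the goal is `⊥`.
  ¬¬-∀Fin : ∀ {a n} {P : Fin n → Set a} → (∀ i → ¬ ¬ P i) → ¬ ¬ (∀ i → P i)
  ¬¬-∀Fin {n = zero}  ¬¬P ¬∀ = ¬∀ λ ()
  ¬¬-∀Fin {n = suc n} ¬¬P ¬∀ = ¬¬P zero λ P0 → ¬¬-∀Fin (¬¬P ∘ suc) λ Ps →
    ¬∀ λ { zero → P0 ; (suc i) → Ps i }

  funToFin-cong : ∀ {m n} {f g : Fin m → Fin n} → f ≗ g → funToFin f ≡ funToFin g
  funToFin-cong {zero}  f≗g = refl
  funToFin-cong {suc m} f≗g = cong₂ combine (f≗g zero) (funToFin-cong (f≗g ∘ suc))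

  funToFin-injective : ∀ {m n} {f g : Fin m → Fin n} → funToFin f ≡ funToFin g → f ≗ g
  funToFin-injective {f = f} {g} eq i = begin
    f i                     ≡⟨ Fin.finToFun-funToFin f i ⟨
    finToFun (funToFin f) i ≡⟨ cong (λ z → finToFun z i) eq ⟩
    finToFun (funToFin g) i ≡⟨ Fin.finToFun-funToFin g i ⟩
    g i                     ∎
    where open ≡-Reasoning

  finToFun-injective : ∀ {m n} {b b′ : Fin (n ^ m)} → finToFun {n} {m} b ≗ finToFun b′ → b ≡ b′
  finToFun-injective {m} {n} {b} {b′} eq = begin
    b                     ≡⟨ Fin.funToFin-finToFin {m} {n} b ⟨
    funToFin (finToFun {n} {m} b)  ≡⟨ funToFin-cong {m} eq ⟩
    funToFin (finToFun {n} {m} b′) ≡⟨ Fin.funToFin-finToFin {m} {n} b′ ⟩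
    b′                    ∎
    where open ≡-Reasoning

  Vec-≡ : ∀ {a} {A : Set a} {n} {xs ys : Vec A n} → Vec.lookup xs ≗ Vec.lookup ys → xs ≡ ys
  Vec-≡ {xs = xs} {ys} eq = begin
    xs                          ≡⟨ Vec.tabulate∘lookup xs ⟨
    Vec.tabulate (Vec.lookup xs) ≡⟨ Vec.tabulate-cong eq ⟩
    Vec.tabulate (Vec.lookup ys) ≡⟨ Vec.tabulate∘lookup ys ⟩
    ys                          ∎
    where open ≡-Reasoning

  -- Words cannot represent the incidence graph

  module _ (n D : ℕ) where

    Vertex : Set
    Vertex = Fin (n * D) ⊎ Fin (2 ^ n)

    -- The binary digits of `b` are the characteristic function of a subset of `Fin n`.
    Selects : Fin (2 ^ n) → Fin n → Set
    Selects b x = finToFun {2} {n} b x ≡ suc zero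

    VAdj : Vertex → Vertex → Set
    VAdj (inj₁ a) (inj₂ b) = Selects b (quotient D a)
    VAdj (inj₂ b) (inj₁ a) = Selects b (quotient D a)
    VAdj _        _        = ⊥

    -- A hypothetical representation by a word: `O v` is the set of positions of the letter `v`, and
    -- adjacency is alternation of length `2 + k`. By `large` there are more subsets of `Fin n` than
    -- codes.
    module _ {k m : ℕ} (k+2≤D : 2 + k ≤ D)
      (large : (2 + n * D * (n * D * k)) ^ (2 + k) < 2 ^ n)
      (O : Vertex → ℕ → Set) (O? : ∀ v → Decidable (O v)) (O<m : ∀ v → Bounded m (O v))
      (disjoint : ∀ {u v} → u ≢ v → Disjoint (O u) (O v))
      (alternating⇒adj : ∀ {u v} → u ≢ v → Alternating (2 + k) (O u) (O v) → VAdj u v)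
      (adj⇒alternating : ∀ {u v} → VAdj u v → Alternating (2 + k) (O u) (O v))
      where

      -- Distinct letters of A are not adjacent, hence separated by at most `k` cuts; the parity of
      -- the rank then tells them apart.
      separator : ∀ a a′ → ∃ λ φ → Monotone φ × (∀ p → φ p ≤ k) ×
        (∀ {p q} → O (inj₁ a) p → O (inj₁ a′) q → φ p ≡ φ q → a ≡ a′)
      separator a a′ with a Fin.≟ a′
      ... | yes a≡a′ = const 0 , (λ _ → z≤n) , (λ _ → z≤n) , λ _ _ _ → a≡a′
      ... | no  a≢a′
        with alternating⊎separated (O? (inj₁ a)) (O? (inj₁ a′)) (O<m _) (O<m _)
               (disjoint (a≢a′ ∘ inj₁-injective)) k
      ...   | inj₁ alt = ⊥-elim (alternating⇒adj (a≢a′ ∘ inj₁-injective) alt)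
      ...   | inj₂ (cs , len , b , onA , onA′) =
              rank cs , rank-mono cs , (λ p → ≤-trans (rank≤length cs p) len) ,
              λ x y eq → contradiction (trans (trans (sym (onA x)) (cong odd eq)) (onA′ y)) (not-¬ {b} refl)

      L : ℕ
      L = n * D * (n * D * k)

      -- The separators of all pairs are refined together, first over `a′` and then over `a`; each
      -- refinement multiplies the bound by `n * D`.
      interval : ∃ λ idx → Monotone idx × (∀ p → idx p ≤ L) ×
        (∀ {a a′ p q} → O (inj₁ a) p → O (inj₁ a′) q → idx p ≡ idx q → a ≡ a′)
      interval =
        let rows a = commonRefinement (λ a′ → proj₁ (separator a a′)) (λ a′ → proj₁ (proj₂ (separator a a′)))
                           (λ a′ → proj₁ (proj₂ (proj₂ (separator a a′))))
            idx , mono , bound , fine =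
              commonRefinement (λ a → proj₁ (rows a)) (λ a → proj₁ (proj₂ (rows a)))
                                  (λ a → proj₁ (proj₂ (proj₂ (rows a))))
        in idx , mono , bound , λ {a} {a′} x y eq →
             proj₂ (proj₂ (proj₂ (separator a a′))) x y (proj₂ (proj₂ (proj₂ (rows a))) a′ (fine a eq))

      idx : ℕ → ℕ
      idx = proj₁ interval

      idx-mono : Monotone idx
      idx-mono = proj₁ (proj₂ interval)

      idx-≤ : ∀ p → idx p ≤ L
      idx-≤ = proj₁ (proj₂ (proj₂ interval))

      idx-determines : ∀ {a a′ p q} → O (inj₁ a) p → O (inj₁ a′) q → idx p ≡ idx q → a ≡ a′
      idx-determines = proj₂ (proj₂ (proj₂ interval))

      I : Vertex → ℕ → Set
      I v = Img idx (O v)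

      I? : ∀ v → Decidable (I v)
      I? v = Img? (O? v) (O<m v)

      I<M : ∀ v → Bounded (suc L) (I v)
      I<M v (p , _ , refl) = s≤s (idx-≤ p)

      codeOf : Fin (2 ^ n) → Vec ℕ (2 + k)
      codeOf b = code (I? (inj₂ b)) (I<M (inj₂ b)) (2 + k) 0

      -- An entry is an interval index, at most `L`, or the padding `suc L`, so there are `2 + L`
      -- possible digits.
      codeOf-≤ : ∀ b i → Vec.lookup (codeOf b) i < 2 + L
      codeOf-≤ b i = s≤s (code-≤ (I? (inj₂ b)) (I<M (inj₂ b)) (2 + k) 0 i)

      digits : Fin (2 ^ n) → Fin (2 + k) → Fin (2 + L)
      digits b i = fromℕ< (codeOf-≤ b i)

      encode : Fin (2 ^ n) → Fin ((2 + L) ^ (2 + k))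
      encode b = funToFin (digits b)

      encode-≡ : ∀ {b b′} → encode b ≡ encode b′ → codeOf b ≡ codeOf b′
      encode-≡ {b} {b′} eq = Vec-≡ λ i →
        Fin.fromℕ<-injective _ _ (codeOf-≤ b i) (codeOf-≤ b′ i)
          (funToFin-injective {f = digits b} {digits b′} eq i)

      -- A full common code makes `b` and `b′` alternate, but letters of B are not adjacent.
      -- Otherwise both visit the same fewer than `2 + k` intervals, and each of the `D` copies of
      -- `x` must visit one of them, so two copies share an interval.
      codes-differ : ∀ {b b′ x} → b ≢ b′ → codeOf b ≡ codeOf b′ →
                     Selects b x → ¬ Selects b′ x → ⊥
      codes-differ {b} {b′} {x} b≢b′ eq sel ¬sel
        with code-≡ (I? (inj₂ b)) (I? (inj₂ b′)) (I<M (inj₂ b)) (I<M (inj₂ b′)) (2 + k) 0 eq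
      ... | inj₁ alt = alternating⇒adj (b≢b′ ∘ inj₂-injective) (inj₁ (Img-Alt idx-mono (λ _ → z≤n) alt))
      ... | inj₂ (js , len , I⊆ , _) = ¬¬-∀Fin hit λ hits →
        let i , i′ , i<i′ , same = Fin.pigeonhole (<-≤-trans len k+2≤D) λ i →
              index (proj₂ (I⊆ z≤n (proj₁ (proj₂ (hits i)))))
        in Fin.<⇒≢ i<i′ (coincide (hits i) (hits i′) same)
        where
        copy : Fin D → Vertex
        copy i = inj₁ (combine x i)
        Hit : Fin D → Set
        Hit i = ∃ λ j → I (inj₂ b) j × I (copy i) j
        coincide : ∀ {i i′} (h : Hit i) (h′ : Hit i′) →
          index (proj₂ (I⊆ z≤n (proj₁ (proj₂ h)))) ≡ index (proj₂ (I⊆ z≤n (proj₁ (proj₂ h′)))) → i ≡ i′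
        coincide {i} {i′} (j , Ij , p , a , φp≡j) (j′ , Ij′ , p′ , a′ , φp′≡j′) same =
          Fin.combine-injectiveʳ x i x i′ (idx-determines a a′ (trans φp≡j (trans j≡j′ (sym φp′≡j′))))
          where
          j≡j′ : j ≡ j′
          j≡j′ = trans (lookup-index (proj₂ (I⊆ z≤n Ij)))
                 (trans (cong (List.lookup js) same) (sym (lookup-index (proj₂ (I⊆ z≤n Ij′)))))
        quotient-copy : ∀ i → quotient {n} D (combine x i) ≡ x
        quotient-copy i = cong proj₁ (Fin.remQuot-combine x i)
        -- If the copy shares no interval with `b`, its alternation with `b` passes to intervals,
        -- where `b` may be replaced by `b′`, and back to positions. Then `b′` would select `x` as
        -- well.
        hit : ∀ i → ¬ ¬ Hit i
        hit i ¬hit = ¬sel (subst (Selects b′) (quotient-copy i)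
                       (alternating⇒adj {copy i} {inj₂ b′} (λ ())
                         (Sum.map transfer transfer′ (adj⇒alternating {copy i} {inj₂ b}
                           (subst (Selects b) (sym (quotient-copy i)) sel)))))
          where
          transfer : Alt (O (copy i)) (O (inj₂ b)) (2 + k) 0 → Alt (O (copy i)) (O (inj₂ b′)) (2 + k) 0
          transfer = Img-Alt idx-mono (λ _ → z≤n) ∘ Alt-map id (proj₁ ∘ I⊆ z≤n)
                   ∘ Alt-Img idx-mono (λ x y → ¬hit (_ , y , x)) (λ _ _ → z≤n)
          transfer′ : Alt (O (inj₂ b)) (O (copy i)) (2 + k) 0 → Alt (O (inj₂ b′)) (O (copy i)) (2 + k) 0
          transfer′ = Img-Alt idx-mono (λ _ → z≤n) ∘ Alt-map (proj₁ ∘ I⊆ z≤n) id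
                    ∘ Alt-Img idx-mono (λ x y → ¬hit (_ , x , y)) (λ _ _ → z≤n)

      -- A digit in which `b` and `b′` differ is selected by exactly one of them, and `codes-differ`
      -- applies in one of the two orders.
      codes-injective : ∀ {b b′} → codeOf b ≡ codeOf b′ → ¬ (b ≢ b′)
      codes-injective {b} {b′} eq b≢b′ =
        ¬¬-∀Fin (λ x → agree x _ _ refl refl) λ same → b≢b′ (finToFun-injective {n} same)
        where
        agree : ∀ x (u v : Fin 2) → finToFun {2} {n} b x ≡ u → finToFun {2} {n} b′ x ≡ v → ¬ (u ≢ v)
        agree x zero       zero       _ _  u≢v = u≢v refl
        agree x (suc zero) (suc zero) _ _  u≢v = u≢v refl
        agree x (suc zero) zero       e e′ _   =
          codes-differ b≢b′ eq e λ s → Fin.0≢1+n (trans (sym e′) s)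
        agree x zero       (suc zero) e e′ _   =
          codes-differ (b≢b′ ∘ sym) (sym eq) e′ λ s → Fin.0≢1+n (trans (sym e) s)

      no-representation : ⊥
      no-representation =
        let b , b′ , b<b′ , eq = Fin.pigeonhole large encode
        in codes-injective (encode-≡ {b} {b′} eq) (Fin.<⇒≢ b<b′)

  -- Choice of the number of ground elements

  -- For `n` a power of two, and each factor `D` bounded by `2 ^ D`, everything becomes a comparison
  -- of exponents, `e * D < 2 ^ s`.
  exponential-dominates : ∀ D → 1 ≤ D → ∃ λ n → (2 + n * D * (n * D * D)) ^ D < 2 ^ n
  exponential-dominates D 1≤D = 2 ^ s , (begin-strict
    (2 + 2 ^ s * D * (2 ^ s * D * D)) ^ D ≤⟨ ^-monoˡ-≤ D base ⟩
    (2 ^ e) ^ D                           ≡⟨ ^-*-assoc 2 e D ⟩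
    2 ^ (e * D)                           <⟨ ^-monoʳ-< 2 (s≤s (s≤s z≤n)) e*D< ⟩
    2 ^ (2 ^ s)                           ∎)
    where
    open ≤-Reasoning
    s e : ℕ
    -- The 4 accounts for the factor 16 in `e≤16D`, and `D + D` for the square of `D`.
    s = 4 + (D + D)
    -- The outer `suc` absorbs the summand 2 of the base.
    e = suc (s + D + (s + D + D))
    D<2^D : ∀ D → D < 2 ^ D
    D<2^D zero    = s≤s z≤n
    D<2^D (suc D) = begin-strict
      suc D           <⟨ s≤s (D<2^D D) ⟩
      suc (2 ^ D)     ≤⟨ +-monoˡ-≤ (2 ^ D) (m^n>0 2 D) ⟩
      2 ^ D + 2 ^ D   ≡⟨ cong (2 ^ D +_) (sym (+-identityʳ _)) ⟩
      2 ^ suc D       ∎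
    D≤2^D : D ≤ 2 ^ D
    D≤2^D = <⇒≤ (D<2^D D)
    product : 2 ^ s * D * (2 ^ s * D * D) ≤ 2 ^ (s + D + (s + D + D))
    product = begin
      2 ^ s * D * (2 ^ s * D * D)              ≤⟨ *-mono-≤ (*-monoʳ-≤ (2 ^ s) D≤2^D)
                                                  (*-mono-≤ (*-monoʳ-≤ (2 ^ s) D≤2^D) D≤2^D) ⟩
      2 ^ s * 2 ^ D * (2 ^ s * 2 ^ D * 2 ^ D)  ≡⟨ cong₂ _*_ (^-distribˡ-+-* 2 s D)
                                                  (cong (_* 2 ^ D) (^-distribˡ-+-* 2 s D)) ⟨
      2 ^ (s + D) * (2 ^ (s + D) * 2 ^ D)      ≡⟨ cong (2 ^ (s + D) *_) (^-distribˡ-+-* 2 (s + D) D) ⟨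
      2 ^ (s + D) * 2 ^ (s + D + D)            ≡⟨ ^-distribˡ-+-* 2 (s + D) (s + D + D) ⟨
      2 ^ (s + D + (s + D + D))                ∎
    base : 2 + 2 ^ s * D * (2 ^ s * D * D) ≤ 2 ^ e
    base = begin
      2 + 2 ^ s * D * (2 ^ s * D * D)    ≤⟨ +-mono-≤ (^-monoʳ-≤ 2 {1} {pred e} (s≤s z≤n)) product ⟩
      2 ^ pred e + 2 ^ pred e            ≡⟨ cong (2 ^ pred e +_) (sym (+-identityʳ _)) ⟩
      2 ^ e                              ∎
    e*D< : e * D < 2 ^ s
    e*D< = begin-strict
      e * D                    ≤⟨ *-monoˡ-≤ D e≤16D ⟩
      16 * D * D               ≡⟨ *-assoc 16 D D ⟩
      16 * (D * D)             <⟨ *-monoʳ-< 16 (*-mono-< (D<2^D D) (D<2^D D)) ⟩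
      16 * (2 ^ D * 2 ^ D)     ≡⟨ cong (16 *_) (^-distribˡ-+-* 2 D D) ⟨
      16 * 2 ^ (D + D)         ≡⟨ ^-distribˡ-+-* 2 4 (D + D) ⟨
      2 ^ s                    ∎
      where
      e≡ : ∀ D → suc (4 + (D + D) + D + (4 + (D + D) + D + D)) ≡ 7 * D + 9 * 1
      e≡ = solve-∀
      e≤16D : e ≤ 16 * D
      e≤16D = begin
        e               ≡⟨ e≡ D ⟩
        7 * D + 9 * 1   ≤⟨ +-monoʳ-≤ (7 * D) (*-monoʳ-≤ 9 1≤D) ⟩
        7 * D + 9 * D   ≡⟨ *-distribʳ-+ D 7 9 ⟨
        16 * D          ∎

-- Nerves of labelled points on the moment curve

module MomentCurve {ℓ ℓ₁ ℓ₂} (F : CompleteOrderedField ℓ ℓ₁ ℓ₂) where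

  open Alternation
  open CompleteOrderedField F hiding (zero)
  open Geometry F
  private module O = IsTotalOrder ≤-isTotalOrder
  open import Algebra.Properties.Ring ring
  open import Algebra.Properties.Semiring.Exp semiring using (_^_)
  open import Algebra.Properties.Monoid.Mult +-monoid using (×-homo-+) renaming (_×_ to _·_)
  open import Algebra.Properties.Semiring.Sum semiring
    using (sum; ∑-distrib-+; ∑-comm; *-distribˡ-sum)
  open import Algebra.Solver.Ring.NaturalCoefficients.Default commutativeSemiring
    using (solve; _:=_; _:+_; _:*_; con)
  open import Relation.Binary.Reasoning.Setoid setoid

  -- Signs in an ordered field

  Nonneg : Carrier → Set ℓ₂
  Nonneg x = 0# ≤F x

  nonneg-resp : ∀ {x y} → x ≈ y → Nonneg x → Nonneg y
  nonneg-resp = O.≤-respʳ-≈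

  nonneg-0 : ∀ {x} → x ≈ 0# → Nonneg x
  nonneg-0 x≈0 = O.reflexive (sym x≈0)

  nonneg-+ : ∀ {x y} → Nonneg x → Nonneg y → Nonneg (x + y)
  nonneg-+ {x} {y} 0≤x 0≤y = O.trans 0≤y (O.≤-respˡ-≈ (+-identityˡ y) (+-mono-≤ y 0≤x))

  nonneg⊎nonneg-neg : ∀ x → Nonneg x ⊎ Nonneg (- x)
  nonneg⊎nonneg-neg x with O.total 0# x
  ... | inj₁ 0≤x = inj₁ 0≤x
  ... | inj₂ x≤0 = inj₂ (O.≤-respˡ-≈ (-‿inverseʳ x) (nonneg-resp′ (+-mono-≤ (- x) x≤0)))
    where
    nonneg-resp′ : (x + - x) ≤F (0# + - x) → (x + - x) ≤F (- x)
    nonneg-resp′ = O.≤-respʳ-≈ (+-identityˡ (- x))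

  nonneg-antisym : ∀ {x} → Nonneg x → Nonneg (- x) → x ≈ 0#
  nonneg-antisym {x} 0≤x 0≤-x = O.antisym
    (O.≤-respˡ-≈ (+-identityˡ x) (O.≤-respʳ-≈ (-‿inverseˡ x) (+-mono-≤ x 0≤-x))) 0≤x

  nonneg-+≈0ˡ : ∀ {x y} → Nonneg x → Nonneg y → x + y ≈ 0# → x ≈ 0#
  nonneg-+≈0ˡ {x} {y} 0≤x 0≤y x+y≈0 = nonneg-antisym 0≤x (nonneg-resp (+-inverseʳ-unique x y x+y≈0) 0≤y)

  nonneg-+≈0ʳ : ∀ {x y} → Nonneg x → Nonneg y → x + y ≈ 0# → y ≈ 0#
  nonneg-+≈0ʳ 0≤x 0≤y x+y≈0 = nonneg-+≈0ˡ 0≤y 0≤x (trans (+-comm _ _) x+y≈0)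

  nonneg-1 : Nonneg 1#
  nonneg-1 with nonneg⊎nonneg-neg 1#
  ... | inj₁ 0≤1  = 0≤1
  ... | inj₂ 0≤-1 = nonneg-resp (trans (-1*x≈-x (- 1#)) (-‿involutive 1#)) (*-nonneg 0≤-1 0≤-1)

  *-cancel-≈0 : ∀ {x y} → ¬ y ≈ 0# → x * y ≈ 0# → x ≈ 0#
  *-cancel-≈0 {x} {y} y≉0 xy≈0 with inverse y y≉0
  ... | z , yz≈1 = begin
    x           ≈⟨ *-identityʳ x ⟨
    x * 1#      ≈⟨ *-congˡ yz≈1 ⟨
    x * (y * z) ≈⟨ *-assoc x y z ⟨
    x * y * z   ≈⟨ *-congʳ xy≈0 ⟩
    0# * z      ≈⟨ zeroˡ z ⟩
    0#          ∎

  -- Strict positivity, expressed through the weak order of the axioms.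
  Pos : Carrier → Set _
  Pos x = Nonneg x × ¬ x ≈ 0#

  pos-resp : ∀ {x y} → x ≈ y → Pos x → Pos y
  pos-resp x≈y (0≤x , x≉0) = nonneg-resp x≈y 0≤x , λ y≈0 → x≉0 (trans x≈y y≈0)

  pos-1 : Pos 1#
  pos-1 = nonneg-1 , 0≉1 ∘ sym

  pos-* : ∀ {x y} → Pos x → Pos y → Pos (x * y)
  pos-* (0≤x , x≉0) (0≤y , y≉0) = *-nonneg 0≤x 0≤y , x≉0 ∘ *-cancel-≈0 y≉0

  pos-+ : ∀ {x y} → Pos x → Nonneg y → Pos (x + y)
  pos-+ (0≤x , x≉0) 0≤y = nonneg-+ 0≤x 0≤y , x≉0 ∘ nonneg-+≈0ˡ 0≤x 0≤y

  pos-inverse : ∀ {x} → Pos x → ∃ λ y → x * y ≈ 1# × Pos y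
  pos-inverse {x} (0≤x , x≉0) with inverse x x≉0
  ... | y , xy≈1 = y , xy≈1 , 0≤y (nonneg⊎nonneg-neg y) ,
    λ y≈0 → 0≉1 (trans (sym (trans (*-congˡ y≈0) (zeroʳ x))) xy≈1)
    where
    0≤y : Nonneg y ⊎ Nonneg (- y) → Nonneg y
    0≤y (inj₁ 0≤y)  = 0≤y
    -- Otherwise `x * - y`, which is -1, would be nonnegative, and 1 would be zero.
    0≤y (inj₂ 0≤-y) = contradiction
      (nonneg-antisym nonneg-1
        (nonneg-resp (trans (sym (-‿distribʳ-* x y)) (-‿cong xy≈1)) (*-nonneg 0≤x 0≤-y)))
      (0≉1 ∘ sym)

  pos-cancelʳ : ∀ {x y} → Pos y → Pos (x * y) → Pos x
  pos-cancelʳ {x} {y} 0<y 0<xy with pos-inverse 0<y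
  ... | z , yz≈1 , 0<z = pos-resp (trans (*-assoc x y z) (trans (*-congˡ yz≈1) (*-identityʳ x))) (pos-* 0<xy 0<z)

  -- Finite sums

  ∑≡sum : ∀ {m} (f : Fin m → Carrier) → ∑ f ≡ sum f
  ∑≡sum {zero}  f = ≡.refl
  ∑≡sum {suc m} f = ≡.cong (f zero +_) (∑≡sum (f ∘ suc))

  ∑≈sum : ∀ {m} (f : Fin m → Carrier) → ∑ f ≈ sum f
  ∑≈sum f = reflexive (∑≡sum f)

  ∑-cong : ∀ {m} {f g : Fin m → Carrier} → (∀ i → f i ≈ g i) → ∑ f ≈ ∑ g
  ∑-cong {zero}  f≈g = refl
  ∑-cong {suc m} f≈g = +-cong (f≈g zero) (∑-cong (f≈g ∘ suc))

  ∑-zero : ∀ {m} {f : Fin m → Carrier} → (∀ i → f i ≈ 0#) → ∑ f ≈ 0#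
  ∑-zero {zero}  f≈0 = refl
  ∑-zero {suc m} f≈0 = trans (+-cong (f≈0 zero) (∑-zero (f≈0 ∘ suc))) (+-identityʳ 0#)

  ∑-+ : ∀ {m} (f g : Fin m → Carrier) → ∑ (λ i → f i + g i) ≈ ∑ f + ∑ g
  ∑-+ f g = begin
    ∑ (λ i → f i + g i)   ≈⟨ ∑≈sum (λ i → f i + g i) ⟩
    sum (λ i → f i + g i) ≈⟨ ∑-distrib-+ f g ⟩
    sum f + sum g         ≈⟨ +-cong (∑≈sum f) (∑≈sum g) ⟨
    ∑ f + ∑ g             ∎

  *-∑ : ∀ {m} x (f : Fin m → Carrier) → x * ∑ f ≈ ∑ (λ i → x * f i)
  *-∑ x f = begin
    x * ∑ f             ≈⟨ *-congˡ (∑≈sum f) ⟩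
    x * sum f           ≈⟨ *-distribˡ-sum x f ⟩
    sum (λ i → x * f i) ≈⟨ ∑≈sum (λ i → x * f i) ⟨
    ∑ (λ i → x * f i)   ∎

  ∑-swap : ∀ {m n} (f : Fin m → Fin n → Carrier) →
           ∑ (λ i → ∑ (λ j → f i j)) ≈ ∑ (λ j → ∑ (λ i → f i j))
  ∑-swap f = begin
    ∑ (λ i → ∑ (f i))               ≈⟨ ∑-cong (λ i → ∑≈sum (f i)) ⟩
    ∑ (λ i → sum (f i))             ≈⟨ ∑≈sum (λ i → sum (f i)) ⟩
    sum (λ i → sum (f i))           ≈⟨ ∑-comm f ⟩
    sum (λ j → sum (λ i → f i j))   ≈⟨ ∑≈sum (λ j → sum (λ i → f i j)) ⟨
    ∑ (λ j → sum (λ i → f i j))     ≈⟨ ∑-cong (λ j → ∑≈sum (λ i → f i j)) ⟨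
    ∑ (λ j → ∑ (λ i → f i j))       ∎

  ∑-single : ∀ {m} {f : Fin m → Carrier} i → (∀ j → j ≢ i → f j ≈ 0#) → ∑ f ≈ f i
  ∑-single {suc m} {f} zero    f≈0 =
    trans (+-congˡ (∑-zero (λ j → f≈0 (suc j) λ ()))) (+-identityʳ (f zero))
  ∑-single {suc m} {f} (suc i) f≈0 =
    trans (+-cong (f≈0 zero λ ()) (∑-single i λ j j≢i → f≈0 (suc j) (j≢i ∘ Fin.suc-injective)))
          (+-identityˡ (f (suc i)))

  ∑-nonneg : ∀ {m} {f : Fin m → Carrier} → (∀ i → Nonneg (f i)) → Nonneg (∑ f)
  ∑-nonneg {zero}  0≤f = nonneg-0 refl
  ∑-nonneg {suc m} 0≤f = nonneg-+ (0≤f zero) (∑-nonneg (0≤f ∘ suc))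

  ∑-nonneg-≈0 : ∀ {m} {f : Fin m → Carrier} → (∀ i → Nonneg (f i)) → ∑ f ≈ 0# → ∀ i → f i ≈ 0#
  ∑-nonneg-≈0 0≤f ∑≈0 zero    = nonneg-+≈0ˡ (0≤f zero) (∑-nonneg (0≤f ∘ suc)) ∑≈0
  ∑-nonneg-≈0 0≤f ∑≈0 (suc i) =
    ∑-nonneg-≈0 (0≤f ∘ suc) (nonneg-+≈0ʳ (0≤f zero) (∑-nonneg (0≤f ∘ suc)) ∑≈0) i

  -- Natural numbers in the field

  ι : ℕ → Carrier
  ι n = n · 1#

  ι-nonneg : ∀ n → Nonneg (ι n)
  ι-nonneg zero    = nonneg-0 refl
  ι-nonneg (suc n) = nonneg-+ nonneg-1 (ι-nonneg n)

  ι-< : ∀ {m n} → m ℕ.< n → Pos (ι n - ι m)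
  ι-< {m} {suc n} (s≤s m≤n) = pos-resp difference (pos-+ pos-1 (ι-nonneg (n ℕ.∸ m)))
    where
    difference : ι (suc (n ℕ.∸ m)) ≈ ι (suc n) - ι m
    difference = begin
      ι (suc (n ℕ.∸ m))                    ≈⟨ xyx⁻¹≈y (ι m) _ ⟨
      ι m + ι (suc (n ℕ.∸ m)) - ι m        ≈⟨ +-congʳ (×-homo-+ 1# m (suc (n ℕ.∸ m))) ⟨
      ι (m ℕ.+ suc (n ℕ.∸ m)) - ι m        ≡⟨ ≡.cong (λ z → ι z - ι m)
                                                (≡.trans (ℕ.+-suc m _) (≡.cong suc (ℕ.m+[n∸m]≡n m≤n))) ⟩
      ι (suc n) - ι m                      ∎

  -- Polynomials with prescribed roots

  rootProduct : List Carrier → Carrier → Carrier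
  rootProduct []       t = 1#
  rootProduct (ρ ∷ ρs) t = (ρ - t) * rootProduct ρs t

  rootProduct-pos : ∀ {ρs t} → All (λ ρ → Pos (ρ - t)) ρs → Pos (rootProduct ρs t)
  rootProduct-pos []         = pos-1
  rootProduct-pos (pos ∷ ps) = pos-* pos (rootProduct-pos ps)

  rootProduct-≉0 : ∀ {ρs t} → All (λ ρ → ¬ ρ - t ≈ 0#) ρs → ¬ rootProduct ρs t ≈ 0#
  rootProduct-≉0 []         = 0≉1 ∘ sym
  rootProduct-≉0 (≉0 ∷ ≉0s) = ≉0 ∘ *-cancel-≈0 (rootProduct-≉0 ≉0s)

  rootProduct-root : ∀ {ρs ρ} → ρ ∈ ρs → rootProduct ρs ρ ≈ 0#
  rootProduct-root (here ≡.refl) = trans (*-congʳ (-‿inverseʳ _)) (zeroˡ _)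
  rootProduct-root (there ρ∈ρs)  = trans (*-congˡ (rootProduct-root ρ∈ρs)) (zeroʳ _)

  -- The weights `c` at the nodes `τ` annihilate all polynomials of degree below `r`. For
  -- `r = suc d` this is an affine dependence of points on the moment curve in dimension `d`.
  Vanishing : ∀ {k} → ℕ → (Fin k → Carrier) → (Fin k → Carrier) → Set _
  Vanishing r c τ = ∀ s → s ℕ.< r → ∑ (λ j → c j * τ j ^ s) ≈ 0#

  -- Expanding one factor `ρ - t` leaves a sum with `t ^ s` and one with `t ^ suc s`; the induction
  -- on the roots therefore runs for all `s` at once.
  vanishing-rootProduct : ∀ {k r} {c τ : Fin k → Carrier} → Vanishing r c τ →
    ∀ ρs s → length ρs ℕ.+ s ℕ.< r → ∑ (λ j → c j * (τ j ^ s * rootProduct ρs (τ j))) ≈ 0#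
  vanishing-rootProduct {k} {c = c} {τ} van [] s s<r =
    trans (∑-cong λ (j : Fin k) → *-congˡ {c j} (*-identityʳ (τ j ^ s))) (van s s<r)
  vanishing-rootProduct {k} {r} {c} {τ} van (ρ ∷ ρs) s lt = begin
    ∑ (λ j → c j * (τ j ^ s * ((ρ - τ j) * rootProduct ρs (τ j))))  ≈⟨ ∑-cong expand ⟩
    ∑ (λ j → ρ * T s j + - 1# * T (suc s) j)        ≈⟨ ∑-+ (λ j → ρ * T s j) (λ j → - 1# * T (suc s) j) ⟩
    ∑ (λ j → ρ * T s j) + ∑ (λ j → - 1# * T (suc s) j) ≈⟨ +-cong (*-∑ ρ (T s)) (*-∑ (- 1#) (T (suc s))) ⟨
    ρ * ∑ (T s) + - 1# * ∑ (T (suc s))              ≈⟨ +-cong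
      (*-congˡ (vanishing-rootProduct {r = r} {c} {τ} van ρs s (ℕ.<-trans (ℕ.n<1+n (length ρs ℕ.+ s)) lt)))
      (*-congˡ (vanishing-rootProduct {r = r} {c} {τ} van ρs (suc s)
        (≡.subst (ℕ._< r) (≡.sym (ℕ.+-suc (length ρs) s)) lt))) ⟩
    ρ * 0# + - 1# * 0#                              ≈⟨ +-cong (zeroʳ ρ) (zeroʳ (- 1#)) ⟩
    0# + 0#                                         ≈⟨ +-identityʳ 0# ⟩
    0#                                              ∎
    where
    T : ℕ → Fin k → Carrier
    T s j = c j * (τ j ^ s * rootProduct ρs (τ j))
    expand : ∀ j → c j * (τ j ^ s * ((ρ - τ j) * rootProduct ρs (τ j))) ≈ ρ * T s j + - 1# * T (suc s) j
    expand j = trans (*-congˡ (*-congˡ (*-congʳ (+-congˡ (sym (-1*x≈-x (τ j)))))))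
      (solve 6 (λ c p ρ n t q →
        c :* (p :* ((ρ :+ n :* t) :* q)) := ρ :* (c :* (p :* q)) :+ n :* (c :* ((t :* p) :* q)))
        refl (c j) (τ j ^ s) ρ (- 1#) (τ j) (rootProduct ρs (τ j)))

  -- Divided differences and their signs

  even : ∀ {n} → Fin n → Bool
  even zero    = true
  even (suc i) = not (even i)

  ± : Bool → Carrier → Carrier
  ± true  x = x
  ± false x = - x

  ±-* : ∀ b {x y} → Pos (± b x) → Pos y → Pos (± b (x * y))
  ±-* true  = pos-*
  ±-* false {x} {y} px py = pos-resp (sym (-‿distribˡ-* x y)) (pos-* px py)

  ±-resp : ∀ b {x y} → x ≈ y → Pos (± b x) → Pos (± b y)
  ±-resp true  = pos-resp
  ±-resp false = pos-resp ∘ -‿cong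

  ±-not-neg : ∀ b {x} → Pos (± b x) → Pos (± (not b) (- 1# * x))
  ±-not-neg true  {x} = pos-resp (trans (sym (-‿involutive x)) (-‿cong (sym (-1*x≈-x x))))
  ±-not-neg false {x} = pos-resp (sym (-1*x≈-x x))

  Increasing : ∀ {k} → (Fin k → Carrier) → Set _
  Increasing τ = ∀ {i j} → i Fin.< j → Pos (τ j - τ i)

  -- c (suc j) = - u j / (τ (suc j) - τ zero), where u solves the problem for τ ∘ suc, and c zero makes the
  -- sum vanish; its sign is found by testing c against a polynomial with roots at all but the first two nodes.
  dividedDifference : ∀ r (τ : Fin (suc r) → Carrier) → Increasing τ →
    ∃ λ c → (∀ i → Pos (± (even i) (c i))) × Vanishing r c τ
  dividedDifference zero    τ inc = (λ _ → 1#) , (λ { zero → pos-1 }) , λ s ()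
  dividedDifference (suc r) τ inc with dividedDifference r (τ ∘ suc) (inc ∘ s≤s)
  ... | u , u-sign , u-van = c , c-sign , c-van
    where
    δ : Fin (suc r) → Carrier
    δ j = τ (suc j) - τ zero
    δ⁻¹ : ∀ j → ∃ λ y → δ j * y ≈ 1# × Pos y
    δ⁻¹ j = pos-inverse (inc {zero} {suc j} (s≤s z≤n))
    e : Fin (suc r) → Carrier
    e j = u j * proj₁ (δ⁻¹ j)
    e-sign : ∀ j → Pos (± (even j) (e j))
    e-sign j = ±-* (even j) (u-sign j) (proj₂ (proj₂ (δ⁻¹ j)))
    e*δ : ∀ j → e j * δ j ≈ u j
    e*δ j = begin
      u j * proj₁ (δ⁻¹ j) * δ j   ≈⟨ *-assoc _ _ _ ⟩
      u j * (proj₁ (δ⁻¹ j) * δ j) ≈⟨ *-congˡ (*-comm _ _) ⟩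
      u j * (δ j * proj₁ (δ⁻¹ j)) ≈⟨ *-congˡ (proj₁ (proj₂ (δ⁻¹ j))) ⟩
      u j * 1#                    ≈⟨ *-identityʳ (u j) ⟩
      u j                         ∎
    c : Fin (suc (suc r)) → Carrier
    c zero    = ∑ e
    c (suc j) = - 1# * e j
    c-van : Vanishing (suc r) c τ
    c-van zero _ = begin
      ∑ e * 1# + ∑ (λ j → - 1# * e j * 1#) ≈⟨ +-cong (*-identityʳ (∑ e))
                                                        (∑-cong λ (j : Fin (suc r)) → *-identityʳ (- 1# * e j)) ⟩
      ∑ e + ∑ (λ j → - 1# * e j)           ≈⟨ +-congˡ (*-∑ (- 1#) e) ⟨
      ∑ e + - 1# * ∑ e                     ≈⟨ +-congˡ (-1*x≈-x (∑ e)) ⟩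
      ∑ e - ∑ e                            ≈⟨ -‿inverseʳ (∑ e) ⟩
      0#                                   ∎
    -- Writing one factor `τ (suc j)` as `δ j + τ zero` and using `e*δ` reduces the moment `suc s`
    -- of `c` to the moments `s` of `c` and `u`.
    c-van (suc s) (s≤s s<r) = begin
      ∑ e * (τ zero * τ zero ^ s) + ∑ (λ j → - 1# * e j * (τ (suc j) * τ (suc j) ^ s))
        ≈⟨ +-cong (solve 3 (λ x t p → x :* (t :* p) := t :* (x :* p)) refl (∑ e) (τ zero) (τ zero ^ s))
                  (∑-cong shift) ⟩
      τ zero * (∑ e * τ zero ^ s) + ∑ (λ j → τ zero * E j + - 1# * U j)
        ≈⟨ +-congˡ (trans (∑-+ (λ j → τ zero * E j) (λ j → - 1# * U j))
                          (sym (+-cong (*-∑ (τ zero) E) (*-∑ (- 1#) U)))) ⟩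
      τ zero * (∑ e * τ zero ^ s) + (τ zero * ∑ E + - 1# * ∑ U)
        ≈⟨ solve 5 (λ t x y n z → t :* x :+ (t :* y :+ n :* z) := t :* (x :+ y) :+ n :* z) refl
             (τ zero) (∑ e * τ zero ^ s) (∑ E) (- 1#) (∑ U) ⟩
      τ zero * ∑ (λ i → c i * τ i ^ s) + - 1# * ∑ U
        ≈⟨ +-cong (*-congˡ (c-van s (ℕ.m<n⇒m<1+n s<r))) (*-congˡ (u-van s s<r)) ⟩
      τ zero * 0# + - 1# * 0#    ≈⟨ +-cong (zeroʳ _) (zeroʳ _) ⟩
      0# + 0#                    ≈⟨ +-identityʳ 0# ⟩
      0#                         ∎
      where
      E U : Fin (suc r) → Carrier
      E j = - 1# * e j * τ (suc j) ^ s
      U j = u j * τ (suc j) ^ s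
      shift : ∀ j → - 1# * e j * (τ (suc j) * τ (suc j) ^ s) ≈ τ zero * E j + - 1# * U j
      shift j = begin
        - 1# * e j * (τ (suc j) * p)          ≈⟨ *-congˡ (*-congʳ (//-rightDividesˡ (τ zero) (τ (suc j)))) ⟨
        - 1# * e j * ((δ j + τ zero) * p)
          ≈⟨ solve 5 (λ n e δ t p → n :* e :* ((δ :+ t) :* p) := t :* (n :* e :* p) :+ n :* (e :* δ :* p))
               refl (- 1#) (e j) (δ j) (τ zero) p ⟩
        τ zero * E j + - 1# * (e j * δ j * p) ≈⟨ +-congˡ (*-congˡ (*-congʳ (e*δ j))) ⟩
        τ zero * E j + - 1# * U j             ∎
        where
        p : Carrier
        p = τ (suc j) ^ s
    ρs : List Carrier
    ρs = List.tabulate (λ j → τ (suc (suc j)))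
    Q : Carrier → Carrier
    Q = rootProduct ρs
    Q₀ : Pos (Q (τ zero))
    Q₀ = rootProduct-pos (All.tabulate⁺ λ j → inc {zero} {suc (suc j)} (s≤s z≤n))
    Q₁ : Pos (Q (τ (suc zero)))
    Q₁ = rootProduct-pos (All.tabulate⁺ λ j → inc {suc zero} {suc (suc j)} (s≤s (s≤s z≤n)))
    c₀Q₀ : ∑ e * Q (τ zero) ≈ e zero * Q (τ (suc zero))
    c₀Q₀ = begin
      ∑ e * Q (τ zero)                   ≈⟨ +-inverseˡ-unique _ _ balance ⟩
      - (- 1# * e zero * Q (τ (suc zero))) ≈⟨ -‿cong (trans (*-assoc _ _ _) (-1*x≈-x _)) ⟩
      - - (e zero * Q (τ (suc zero)))    ≈⟨ -‿involutive _ ⟩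
      e zero * Q (τ (suc zero))          ∎
      where
      length-ρs : length ρs ℕ.+ 0 ℕ.< suc r
      length-ρs = ≡.subst (ℕ._< suc r) (≡.sym (≡.trans (ℕ.+-identityʳ _) (List.length-tabulate _)))
                    (ℕ.n<1+n r)
      balance : ∑ e * Q (τ zero) + - 1# * e zero * Q (τ (suc zero)) ≈ 0#
      balance = begin
        ∑ e * Q (τ zero) + - 1# * e zero * Q (τ (suc zero))
          ≈⟨ +-cong (*-congˡ (*-identityˡ _)) (trans (+-identityʳ _) (*-congˡ (*-identityˡ _))) ⟨
        ∑ e * (1# * Q (τ zero)) + (- 1# * e zero * (1# * Q (τ (suc zero))) + 0#)
          ≈⟨ +-congˡ (+-congˡ (∑-zero λ j → trans
               (*-congˡ (trans (*-congˡ (rootProduct-root {ρs} (∈-tabulate⁺ j))) (zeroʳ 1#)))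
               (zeroʳ (- 1# * e (suc j))))) ⟨
        ∑ (λ i → c i * (τ i ^ 0 * Q (τ i)))
          ≈⟨ vanishing-rootProduct {c = c} {τ} c-van ρs 0 length-ρs ⟩
        0# ∎
    c-sign : ∀ i → Pos (± (even i) (c i))
    c-sign zero    = pos-cancelʳ Q₀ (pos-resp (sym c₀Q₀) (pos-* (e-sign zero) Q₁))
    c-sign (suc j) = ±-not-neg (even j) (e-sign j)

  -- Linear dependence

  -- Gaussian elimination. A nonzero entry of row `zero` serves as pivot; if there is none, that row
  -- alone is dependent. The double negation stands in for deciding whether an entry is zero.
  dependence : ∀ r (M : Fin (suc r) → Fin r → Carrier) →
    ¬ ¬ (∃ λ (c : Fin (suc r) → Carrier) → (∃ λ i → ¬ c i ≈ 0#) × ∀ l → ∑ (λ i → c i * M i l) ≈ 0#)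
  dependence zero    M found = found ((λ _ → 1#) , (zero , 0≉1 ∘ sym) , λ ())
  dependence (suc r) M found = ¬¬-∀Fin pivot λ M₀≈0 →
    found (unit , (zero , 0≉1 ∘ sym) , λ l →
      trans (+-cong (trans (*-congˡ (M₀≈0 l)) (zeroʳ 1#)) (∑-zero λ j → zeroˡ (M (suc j) l)))
            (+-identityʳ 0#))
    where
    unit : Fin (suc (suc r)) → Carrier
    unit zero    = 1#
    unit (suc _) = 0#
    pivot : ∀ l → ¬ ¬ M zero l ≈ 0#
    -- These combinations with row `zero` vanish in column `l`, so `punchIn l` keeps just the other
    -- columns.
    pivot l a≉0 = dependence r (λ j l′ → a * M (suc j) (punchIn l l′) + - M (suc j) l * M zero (punchIn l l′))
      λ { (c , (i , ci≉0) , c-dep) → found (lift c ,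
            (suc i , λ aci≈0 → a≉0 (*-cancel-≈0 ci≉0 aci≈0)) , column c c-dep) }
      where
      a : Carrier
      a = M zero l
      lift : (Fin (suc r) → Carrier) → Fin (suc (suc r)) → Carrier
      lift c zero    = ∑ (λ j → c j * - M (suc j) l)
      lift c (suc j) = a * c j
      eliminate : ∀ c m → ∑ (λ i → lift c i * M i m) ≈
                          ∑ (λ j → c j * (a * M (suc j) m + - M (suc j) l * M zero m))
      eliminate c m = begin
        ∑ (λ j → c j * - M (suc j) l) * M zero m + ∑ (λ j → a * c j * M (suc j) m)
          ≈⟨ +-congʳ (trans (*-comm _ _) (*-∑ (M zero m) (λ j → c j * - M (suc j) l))) ⟩
        ∑ (λ j → M zero m * (c j * - M (suc j) l)) + ∑ (λ j → a * c j * M (suc j) m)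
          ≈⟨ ∑-+ (λ j → M zero m * (c j * - M (suc j) l)) (λ j → a * c j * M (suc j) m) ⟨
        ∑ (λ j → M zero m * (c j * - M (suc j) l) + a * c j * M (suc j) m)
          ≈⟨ ∑-cong (λ j → solve 5
               (λ x c n a y → x :* (c :* n) :+ a :* c :* y := c :* (a :* y :+ n :* x)) refl
               (M zero m) (c j) (- M (suc j) l) a (M (suc j) m)) ⟩
        ∑ (λ j → c j * (a * M (suc j) m + - M (suc j) l * M zero m)) ∎
      column : ∀ c → (∀ l′ →
                 ∑ (λ j → c j * (a * M (suc j) (punchIn l l′) + - M (suc j) l * M zero (punchIn l l′))) ≈ 0#) →
               ∀ m → ∑ (λ i → lift c i * M i m) ≈ 0#
      column c c-dep m with l Fin.≟ m
      ... | yes ≡.refl = trans (eliminate c l)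
                         (∑-zero λ j → trans (*-congˡ (cancel (M (suc j) l))) (zeroʳ (c j)))
        where
        cancel : ∀ x → a * x + - x * a ≈ 0#
        cancel x = begin
          a * x + - x * a   ≈⟨ +-cong (*-comm a x) (sym (-‿distribˡ-* x a)) ⟩
          x * a - x * a     ≈⟨ -‿inverseʳ (x * a) ⟩
          0#                ∎
      ... | no l≢m = ≡.subst (λ m → ∑ (λ i → lift c i * M i m) ≈ 0#) (Fin.punchIn-punchOut l≢m)
                       (trans (eliminate c _) (c-dep (punchOut l≢m)))

  -- The moment curve and general position

  -- Positions sit at the odd integers, so that the even integer 2c separates those < c from those ≥ c.
  node cut : ℕ → Carrier
  node q = ι (suc (q ℕ.+ q))
  cut  c = ι (c ℕ.+ c)

  node-< : ∀ {p q} → p ℕ.< q → Pos (node q - node p)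
  node-< p<q = ι-< (s≤s (ℕ.+-mono-< p<q p<q))

  cut≤node : ∀ {c q} → c ℕ.≤ q → Pos (node q - cut c)
  cut≤node c≤q = ι-< (s≤s (ℕ.+-mono-≤ c≤q c≤q))

  node<cut : ∀ {c q} → q ℕ.< c → Pos (cut c - node q)
  node<cut {c} {q} q<c = ι-< (≡.subst (ℕ._≤ c ℕ.+ c) (≡.cong suc (ℕ.+-suc q q)) (ℕ.+-mono-≤ q<c q<c))

  -- Each cut at or below `q` contributes a negative factor and each later cut a positive one.
  rootProduct-sign : ∀ cs q →
    Pos (± (not (odd (rank cs q))) (rootProduct (List.map cut cs) (node q)))
  rootProduct-sign []       q = pos-1
  rootProduct-sign (c ∷ cs) q with c ℕ.≤? q
  ... | no  c≰q = ±-resp b (*-comm _ _) (±-* b (rootProduct-sign cs q) (node<cut (ℕ.≰⇒> c≰q)))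
    where
    b : Bool
    b = not (odd (rank cs q))
  ... | yes c≤q = flip (not (odd (rank cs q))) (rootProduct-sign cs q)
    where
    negate : ∀ x → (cut c - node q) * x ≈ - ((node q - cut c) * x)
    negate x = trans (*-congʳ (sym (⁻¹-anti-homo‿- (node q) (cut c)))) (sym (-‿distribˡ-* _ x))
    flip : ∀ b {x} → Pos (± b x) → Pos (± (not b) ((cut c - node q) * x))
    flip true  {x} p = pos-resp (sym (trans (-‿cong (negate x)) (-‿involutive _))) (pos-* (cut≤node c≤q) p)
    flip false {x} p = pos-resp (sym (trans (negate x) (-‿distribʳ-* _ x))) (pos-* (cut≤node c≤q) p)

  -- The exponents run from 1 to `d`; the monomial of degree 0 enters through the sum of the
  -- weights.
  curve : ∀ {d} → Carrier → Point d
  curve t s = t ^ suc (toℕ s)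

  vanishing : ∀ {d k} {c τ : Fin k → Carrier} → ∑ c ≈ 0# →
    (∀ (s : Fin d) → ∑ (λ j → c j * curve (τ j) s) ≈ 0#) → Vanishing (suc d) c τ
  vanishing {k = k} ∑c coords zero    _         = trans (∑-cong (λ (j : Fin k) → *-identityʳ _)) ∑c
  vanishing {c = c} {τ} ∑c coords (suc s) (s≤s s<d) =
    ≡.subst (λ z → ∑ (λ j → c j * τ j ^ suc z) ≈ 0#) (Fin.toℕ-fromℕ< s<d) (coords (fromℕ< s<d))

  momentPoints : ∀ d m → Fin m → Point d
  momentPoints d m j = curve (node (toℕ j))

  -- If `r + 2` points lie on an `r`-dimensional flat, their `r + 1` affine parameters, counting a
  -- leading 1, are linearly dependent, which gives an affine dependence of the points. Testing it
  -- against a polynomial of degree `r + 1`, at most `d`, with roots at all nodes but one makes each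
  -- coefficient zero.
  momentPoints-generalPosition : ∀ d m → GeneralPosition (momentPoints d m)
  momentPoints-generalPosition d m (suc (suc r)) _ (s≤s 1+r≤d) g g-inj (a , v , on) =
    dependence (suc r) M λ { (c , (i , ci≉0) , dep) → ci≉0 (coefficient c dep i) }
    where
    τ : Fin (suc (suc r)) → Carrier
    τ t = node (toℕ (g t))
    co : Fin (suc (suc r)) → Fin r → Carrier
    co t = proj₁ (on t)
    M : Fin (suc (suc r)) → Fin (suc r) → Carrier
    M t zero    = 1#
    M t (suc l) = co t l
    distinct : ∀ {i j} → i ≢ j → ¬ τ i - τ j ≈ 0#
    distinct {i} {j} i≢j with ℕ.<-cmp (toℕ (g i)) (toℕ (g j))
    ... | tri≈ _ eq _  = contradiction (g-inj (Fin.toℕ-injective eq)) i≢j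
    ... | tri> _ _ j<i = proj₂ (node-< j<i)
    ... | tri< i<j _ _ = λ eq → proj₂ (node-< i<j)
            (trans (sym (⁻¹-anti-homo‿- (τ i) (τ j))) (trans (-‿cong eq) -0#≈0#))
    module _ (c : Fin (suc (suc r)) → Carrier) (dep : ∀ l → ∑ (λ t → c t * M t l) ≈ 0#) where
      ∑c≈0 : ∑ c ≈ 0#
      ∑c≈0 = trans (∑-cong λ t → sym (*-identityʳ (c t))) (dep zero)
      coordinate : ∀ s → ∑ (λ t → c t * curve (τ t) s) ≈ 0#
      coordinate s = begin
        ∑ (λ t → c t * curve (τ t) s)
          ≈⟨ ∑-cong (λ t → trans (*-congˡ (proj₂ (on t) s)) (distribˡ (c t) (a s) _)) ⟩
        ∑ (λ t → c t * a s + c t * ∑ (λ l → co t l * v l s))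
          ≈⟨ ∑-+ (λ t → c t * a s) (λ t → c t * ∑ (λ l → co t l * v l s)) ⟩
        ∑ (λ t → c t * a s) + ∑ (λ t → c t * ∑ (λ l → co t l * v l s))
          ≈⟨ +-cong base direction ⟩
        0# + 0# ≈⟨ +-identityʳ 0# ⟩
        0#      ∎
        where
        base : ∑ (λ t → c t * a s) ≈ 0#
        base = begin
          ∑ (λ t → c t * a s) ≈⟨ ∑-cong (λ t → *-comm (c t) (a s)) ⟩
          ∑ (λ t → a s * c t) ≈⟨ *-∑ (a s) c ⟨
          a s * ∑ c           ≈⟨ *-congˡ ∑c≈0 ⟩
          a s * 0#            ≈⟨ zeroʳ (a s) ⟩
          0#                  ∎
        direction : ∑ (λ t → c t * ∑ (λ l → co t l * v l s)) ≈ 0#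
        direction = begin
          ∑ (λ t → c t * ∑ (λ l → co t l * v l s))
            ≈⟨ ∑-cong (λ t → *-∑ (c t) (λ l → co t l * v l s)) ⟩
          ∑ (λ t → ∑ (λ l → c t * (co t l * v l s)))
            ≈⟨ ∑-swap (λ t l → c t * (co t l * v l s)) ⟩
          ∑ (λ l → ∑ (λ t → c t * (co t l * v l s)))
            ≈⟨ ∑-zero (λ l → begin
                 ∑ (λ t → c t * (co t l * v l s))
                   ≈⟨ ∑-cong (λ t → solve 3 (λ c x v → c :* (x :* v) := v :* (c :* x)) refl
                                (c t) (co t l) (v l s)) ⟩
                 ∑ (λ t → v l s * (c t * co t l))  ≈⟨ *-∑ (v l s) (λ t → c t * co t l) ⟨
                 v l s * ∑ (λ t → c t * co t l)    ≈⟨ *-congˡ (dep (suc l)) ⟩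
                 v l s * 0#                        ≈⟨ zeroʳ (v l s) ⟩
                 0#                                ∎) ⟩
          0# ∎
      coefficient : ∀ i → c i ≈ 0#
      coefficient i = *-cancel-≈0 Q≉0 (begin
        c i * rootProduct ρs (τ i)        ≈⟨ *-congˡ (*-identityˡ _) ⟨
        c i * (1# * rootProduct ρs (τ i)) ≈⟨ ∑-single i others ⟨
        ∑ (λ t → c t * (1# * rootProduct ρs (τ t)))
          ≈⟨ vanishing-rootProduct {c = c} {τ} (vanishing {c = c} {τ} ∑c≈0 coordinate) ρs 0 bound ⟩
        0#                                ∎)
        where
        τ′ : Fin (suc r) → Carrier
        τ′ j = τ (punchIn i j)
        ρs : List Carrier
        ρs = List.tabulate τ′
        bound : length ρs ℕ.+ 0 ℕ.< suc d
        bound = ≡.subst (ℕ._< suc d) (≡.sym (≡.trans (ℕ.+-identityʳ _) (List.length-tabulate τ′)))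
                  (s≤s 1+r≤d)
        Q≉0 : ¬ rootProduct ρs (τ i) ≈ 0#
        Q≉0 = rootProduct-≉0 (All.tabulate⁺ λ j → distinct (Fin.punchInᵢ≢i i j))
        others : ∀ t → t ≢ i → c t * (1# * rootProduct ρs (τ t)) ≈ 0#
        others t t≢i = begin
          c t * (1# * rootProduct ρs (τ t)) ≈⟨ *-congˡ (*-congˡ (rootProduct-root τt∈ρs)) ⟩
          c t * (1# * 0#)                   ≈⟨ *-congˡ (zeroʳ 1#) ⟩
          c t * 0#                          ≈⟨ zeroʳ (c t) ⟩
          0#                                ∎
          where
          τt∈ρs : τ t ∈ ρs
          τt∈ρs = ≡.subst (λ z → τ z ∈ ρs) (Fin.punchIn-punchOut (t≢i ∘ ≡.sym))
                    (∈-tabulate⁺ {f = τ′} (punchOut (t≢i ∘ ≡.sym)))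
  momentPoints-generalPosition d m (suc zero) (s≤s ()) _ _ _ _

  -- Alternation and intersection of hulls

  -- `π j` is the position on the curve of the point with index `j`; a selected subset may be listed
  -- in any order.
  module _ {d m n : ℕ} (π : Fin m → ℕ) (f : Fin m → Fin n) where

    Occ : Fin n → ℕ → Set
    Occ v q = ∃ λ j → f j ≡ v × π j ≡ q

    P : Fin m → Point d
    P j = curve (node (π j))

    chain : ∀ {u v k p} → Alt (Occ u) (Occ v) k p → ∃ λ (g : Fin k → Fin m) →
      (∀ i → p ℕ.≤ π (g i)) × (∀ {i j} → i Fin.< j → π (g i) ℕ.< π (g j)) ×
      (∀ i → f (g i) ≡ (if even i then u else v))
    chain [] = (λ ()) , (λ ()) , (λ {i} → ⊥-elim (Fin.¬Fin0 i)) , (λ ())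
    chain {u} {v} {suc k} {p} (step p≤q (j , fj≡u , ≡.refl) a) with chain a
    ... | g , above , inc , labels = g′ , above′ , inc′ , labels′
      where
      g′ : Fin (suc k) → Fin m
      g′ zero    = j
      g′ (suc i) = g i
      above′ : ∀ i → p ℕ.≤ π (g′ i)
      above′ zero    = p≤q
      above′ (suc i) = ℕ.≤-trans p≤q (ℕ.<⇒≤ (above i))
      inc′ : ∀ {i j} → i Fin.< j → π (g′ i) ℕ.< π (g′ j)
      inc′ {zero}  {suc j} _         = above j
      inc′ {suc i} {suc j} (s≤s i<j) = inc i<j
      labels′ : ∀ i → f (g′ i) ≡ (if even i then u else v)
      labels′ zero = fj≡u
      labels′ (suc i) with even i | labels i
      ... | true  | e = e
      ... | false | e = e

    δ : Fin m → Fin m → Carrier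
    δ i j with i Fin.≟ j
    ... | yes _ = 1#
    ... | no  _ = 0#

    δ-refl : ∀ i → δ i i ≈ 1#
    δ-refl i with i Fin.≟ i
    ... | yes _   = refl
    ... | no  i≢i = contradiction ≡.refl i≢i

    δ-≢ : ∀ {i j} → i ≢ j → δ i j ≈ 0#
    δ-≢ {i} {j} i≢j with i Fin.≟ j
    ... | yes i≡j = contradiction i≡j i≢j
    ... | no  _   = refl

    δ-nonneg : ∀ i j → Nonneg (δ i j)
    δ-nonneg i j with i Fin.≟ j
    ... | yes _ = nonneg-1
    ... | no  _ = nonneg-0 refl

    -- The pushforward of the weights `w` along `g`, as `InConv` asks for weights on all points.
    push : ∀ {k} → (Fin k → Fin m) → (Fin k → Carrier) → Fin m → Carrier
    push g w j = ∑ (λ i → w i * δ (g i) j)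

    ∑-push : ∀ {k} (g : Fin k → Fin m) w (φ : Fin m → Carrier) →
      ∑ (λ j → push g w j * φ j) ≈ ∑ (λ i → w i * φ (g i))
    ∑-push g w φ = begin
      ∑ (λ j → ∑ (λ i → w i * δ (g i) j) * φ j)
        ≈⟨ ∑-cong (λ j → trans (*-comm _ (φ j)) (*-∑ (φ j) (λ i → w i * δ (g i) j))) ⟩
      ∑ (λ j → ∑ (λ i → φ j * (w i * δ (g i) j)))
        ≈⟨ ∑-swap (λ j i → φ j * (w i * δ (g i) j)) ⟩
      ∑ (λ i → ∑ (λ j → φ j * (w i * δ (g i) j)))
        ≈⟨ ∑-cong (λ i → trans (∑-single (g i) (off i)) (on i)) ⟩
      ∑ (λ i → w i * φ (g i)) ∎
      where
      off : ∀ i j → j ≢ g i → φ j * (w i * δ (g i) j) ≈ 0#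
      off i j j≢gi = begin
        φ j * (w i * δ (g i) j) ≈⟨ *-congˡ (*-congˡ (δ-≢ (j≢gi ∘ ≡.sym))) ⟩
        φ j * (w i * 0#)        ≈⟨ *-congˡ (zeroʳ (w i)) ⟩
        φ j * 0#                ≈⟨ zeroʳ (φ j) ⟩
        0#                      ∎
      on : ∀ i → φ (g i) * (w i * δ (g i) (g i)) ≈ w i * φ (g i)
      on i = begin
        φ (g i) * (w i * δ (g i) (g i)) ≈⟨ *-congˡ (*-congˡ (δ-refl (g i))) ⟩
        φ (g i) * (w i * 1#)            ≈⟨ *-congˡ (*-identityʳ (w i)) ⟩
        φ (g i) * w i                   ≈⟨ *-comm (φ (g i)) (w i) ⟩
        w i * φ (g i)                   ∎

    InConv-push : ∀ {k v x} (g : Fin k → Fin m) w → (∀ i → Nonneg (w i)) →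
      (∀ i → f (g i) ≢ v → w i ≈ 0#) → ∑ w ≈ 1# →
      (∀ t → ∑ (λ i → w i * P (g i) t) ≈ x t) → InConv P f v x
    InConv-push g w 0≤w supp ∑w≈1 coords = push g w ,
      (λ j → ∑-nonneg λ i → *-nonneg (0≤w i) (δ-nonneg (g i) j)) ,
      (λ j fj≢v → ∑-zero (vanish j fj≢v)) ,
      (begin
        ∑ (push g w)               ≈⟨ ∑-cong (λ j → *-identityʳ (push g w j)) ⟨
        ∑ (λ j → push g w j * 1#)  ≈⟨ ∑-push g w (λ _ → 1#) ⟩
        ∑ (λ i → w i * 1#)         ≈⟨ ∑-cong (λ i → *-identityʳ (w i)) ⟩
        ∑ w                        ≈⟨ ∑w≈1 ⟩
        1#                         ∎) ,
      (λ t → trans (∑-push g w (λ j → P j t)) (coords t))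
      where
      vanish : ∀ j → f j ≢ _ → ∀ i → w i * δ (g i) j ≈ 0#
      vanish j fj≢v i with g i Fin.≟ j
      ... | yes ≡.refl = trans (*-congʳ (supp i fj≢v)) (zeroˡ 1#)
      ... | no  _      = zeroʳ (w i)

    -- `part true e x` and `part false e x` are the positive and negative parts of a number with
    -- known sign `e`, so no comparison in the field takes place.
    part : Bool → Bool → Carrier → Carrier
    part true  true  x = x
    part false false x = - x
    part _     _     x = 0#

    part-nonneg : ∀ b e {x} → Pos (± e x) → Nonneg (part b e x)
    part-nonneg true  true  (0≤x , _) = 0≤x
    part-nonneg true  false _         = nonneg-0 refl
    part-nonneg false true  _         = nonneg-0 refl
    part-nonneg false false (0≤x , _) = 0≤x

    part-difference : ∀ e x y → part true e x * y ≈ part false e x * y + x * y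
    part-difference true  x y = sym (trans (+-congʳ (zeroˡ y)) (+-identityˡ (x * y)))
    part-difference false x y = sym (begin
      - x * y + x * y ≈⟨ distribʳ y (- x) x ⟨
      (- x + x) * y   ≈⟨ *-congʳ (-‿inverseˡ x) ⟩
      0# * y          ∎)

    part-support : ∀ b e {u v w : Fin n} x →
      w ≡ (if e then u else v) → w ≢ (if b then u else v) → part b e x ≈ 0#
    part-support true  true  x eq ≢ = contradiction eq ≢
    part-support true  false x eq ≢ = refl
    part-support false true  x eq ≢ = refl
    part-support false false x eq ≢ = contradiction eq ≢

    -- The divided difference over `2 + d` nodes is an affine dependence with alternating signs. Its
    -- positive part sits on `u`, its negative part on `v`, and both have the same moments; dividing
    -- by the common total gives the Radon point.
    alternation-meets : ∀ {u v} → Alt (Occ u) (Occ v) (2 ℕ.+ d) 0 →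
      ∃ λ x → InConv P f u x × InConv P f v x
    alternation-meets {u} {v} alt with chain alt
    ... | g , _ , inc , labels with dividedDifference (suc d) (node ∘ π ∘ g) (node-< ∘ inc)
    ...   | c , c-sign , c-van =
      x , inConv true (λ t → refl) , inConv false (λ t → sym (same (suc (toℕ t)) (s≤s (Fin.toℕ<n t))))
      where
      τ : Fin (2 ℕ.+ d) → Carrier
      τ = node ∘ π ∘ g
      half : Bool → Fin (2 ℕ.+ d) → Carrier
      half b i = part b (even i) (c i)
      half-nonneg : ∀ b i → Nonneg (half b i)
      half-nonneg b i = part-nonneg b (even i) (c-sign i)
      halves : ∀ s → s ℕ.< suc d → ∑ (λ i → half true i * τ i ^ s) ≈ ∑ (λ i → half false i * τ i ^ s)
      halves s s<d = begin
        ∑ (λ i → half true i * τ i ^ s)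
          ≈⟨ ∑-cong (λ i → part-difference (even i) (c i) (τ i ^ s)) ⟩
        ∑ (λ i → half false i * τ i ^ s + c i * τ i ^ s)
          ≈⟨ ∑-+ (λ i → half false i * τ i ^ s) (λ i → c i * τ i ^ s) ⟩
        ∑ (λ i → half false i * τ i ^ s) + ∑ (λ i → c i * τ i ^ s)
          ≈⟨ trans (+-congˡ (c-van s s<d)) (+-identityʳ _) ⟩
        ∑ (λ i → half false i * τ i ^ s) ∎
      total-pos : Pos (∑ (half true))
      total-pos = pos-+ (c-sign zero) (∑-nonneg (λ i → half-nonneg true (suc i)))
      scale : ∃ λ y → ∑ (half true) * y ≈ 1# × Pos y
      scale = pos-inverse total-pos
      y : Carrier
      y = proj₁ scale
      w : Bool → Fin (2 ℕ.+ d) → Carrier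
      w b i = y * half b i
      ∑-w : ∀ b (φ : Fin (2 ℕ.+ d) → Carrier) → ∑ (λ i → w b i * φ i) ≈ y * ∑ (λ i → half b i * φ i)
      ∑-w b φ = trans (∑-cong λ i → *-assoc y (half b i) (φ i)) (sym (*-∑ y (λ i → half b i * φ i)))
      same : ∀ s → s ℕ.< suc d → ∑ (λ i → w true i * τ i ^ s) ≈ ∑ (λ i → w false i * τ i ^ s)
      same s s<d = trans (∑-w true (λ i → τ i ^ s))
                     (trans (*-congˡ (halves s s<d)) (sym (∑-w false (λ i → τ i ^ s))))
      x : Point d
      x t = ∑ (λ i → w true i * P (g i) t)
      ∑w : ∀ b → ∑ (w b) ≈ 1#
      ∑w true  = trans (sym (*-∑ y (half true))) (trans (*-comm y _) (proj₁ (proj₂ scale)))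
      ∑w false = begin
        ∑ (w false)               ≈⟨ ∑-cong (λ i → *-identityʳ (w false i)) ⟨
        ∑ (λ i → w false i * 1#)  ≈⟨ same 0 (s≤s z≤n) ⟨
        ∑ (λ i → w true i * 1#)   ≈⟨ ∑-cong (λ i → *-identityʳ (w true i)) ⟩
        ∑ (w true)                ≈⟨ ∑w true ⟩
        1#                        ∎
      inConv : ∀ b → (∀ t → ∑ (λ i → w b i * P (g i) t) ≈ x t) → InConv P f (if b then u else v) x
      inConv b = InConv-push g (w b)
        (λ i → *-nonneg (proj₁ (proj₂ (proj₂ scale))) (half-nonneg b i))
        (λ i f≢ → trans (*-congˡ (part-support b (even i) (c i) (labels i) f≢)) (zeroʳ y))
        (∑w b)

    alternating⇒commonPoint : ∀ {u v} → Alternating (2 ℕ.+ d) (Occ u) (Occ v) →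
      CommonPoint P f (⁅ u ⁆ ∪ ⁅ v ⁆)
    alternating⇒commonPoint {u} {v} = Sum.[ pair ∘ alternation-meets , pair ∘ swap ∘ alternation-meets ]
      where
      swap : (∃ λ x → InConv P f v x × InConv P f u x) → ∃ λ x → InConv P f u x × InConv P f v x
      swap (x , inv , inu) = x , inu , inv
      pair : (∃ λ x → InConv P f u x × InConv P f v x) → CommonPoint P f (⁅ u ⁆ ∪ ⁅ v ⁆)
      pair (x , inu , inv) = x , λ i i∈ →
        Sum.[ (λ i∈u → ≡.subst (λ i → InConv P f i x) (≡.sym (x∈⁅y⁆⇒x≡y u i∈u)) inu)
            , (λ i∈v → ≡.subst (λ i → InConv P f i x) (≡.sym (x∈⁅y⁆⇒x≡y v i∈v)) inv)
            ] (x∈p∪q⁻ ⁅ u ⁆ ⁅ v ⁆ i∈)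

    -- The difference of the two convex combinations annihilates the polynomial. The resulting sum
    -- has nonnegative terms, so each is zero; as the polynomial is nonzero on `u`, all weights of
    -- `u` vanish, although their total is 1.
    separated⇒disjoint : ∀ {u v x} → InConv P f u x → InConv P f v x →
      ∀ ρs → length ρs ℕ.≤ d →
      (∀ j → f j ≡ u → Pos (rootProduct ρs (node (π j)))) →
      (∀ j → f j ≡ v → Pos (- rootProduct ρs (node (π j)))) → ⊥
    separated⇒disjoint {u} {v} (w , 0≤w , w-supp , ∑w , w-coords)
        (w′ , 0≤w′ , w′-supp , ∑w′ , w′-coords) ρs len posQ negQ =
      0≉1 (trans (sym (∑-zero w≈0)) ∑w)
      where
      τ Q : Fin m → Carrier
      τ j = node (π j)
      Q j = rootProduct ρs (τ j)
      c : Fin m → Carrier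
      c j = w j + - 1# * w′ j
      cancel : ∀ (φ : Fin m → Carrier) {y} → ∑ (λ j → w j * φ j) ≈ y → ∑ (λ j → w′ j * φ j) ≈ y →
               ∑ (λ j → c j * φ j) ≈ 0#
      cancel φ {y} eq eq′ = begin
        ∑ (λ j → c j * φ j)
          ≈⟨ ∑-cong (λ j → trans (distribʳ (φ j) _ _) (+-congˡ (*-assoc (- 1#) (w′ j) (φ j)))) ⟩
        ∑ (λ j → w j * φ j + - 1# * (w′ j * φ j))
          ≈⟨ ∑-+ (λ j → w j * φ j) (λ j → - 1# * (w′ j * φ j)) ⟩
        ∑ (λ j → w j * φ j) + ∑ (λ j → - 1# * (w′ j * φ j))
          ≈⟨ +-cong eq (sym (*-∑ (- 1#) (λ j → w′ j * φ j))) ⟩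
        y + - 1# * ∑ (λ j → w′ j * φ j)
          ≈⟨ +-congˡ (trans (*-congˡ eq′) (-1*x≈-x y)) ⟩
        y - y ≈⟨ -‿inverseʳ y ⟩
        0#    ∎
      unit : ∀ {z} → ∑ z ≈ 1# → ∑ (λ j → z j * 1#) ≈ 1#
      unit {z} = trans (∑-cong λ (j : Fin m) → *-identityʳ (z j))
      c-van : Vanishing (suc d) c τ
      c-van = vanishing {c = c} {τ}
        (trans (∑-cong λ j → sym (*-identityʳ (c j))) (cancel (λ _ → 1#) (unit ∑w) (unit ∑w′)))
        (λ s → cancel (λ j → curve (τ j) s) (w-coords s) (w′-coords s))
      wQ : ∀ j → Nonneg (w j * Q j)
      wQ j with f j Fin.≟ u
      ... | yes fj≡u = *-nonneg (0≤w j) (proj₁ (posQ j fj≡u))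
      ... | no  fj≢u = nonneg-0 (trans (*-congʳ (w-supp j fj≢u)) (zeroˡ (Q j)))
      w′Q : ∀ j → Nonneg (w′ j * - Q j)
      w′Q j with f j Fin.≟ v
      ... | yes fj≡v = *-nonneg (0≤w′ j) (proj₁ (negQ j fj≡v))
      ... | no  fj≢v = nonneg-0 (trans (*-congʳ (w′-supp j fj≢v)) (zeroˡ (- Q j)))
      sum≈0 : ∑ (λ j → w j * Q j + w′ j * - Q j) ≈ 0#
      sum≈0 = begin
        ∑ (λ j → w j * Q j + w′ j * - Q j)     ≈⟨ ∑-cong rearrange ⟩
        ∑ (λ j → c j * (1# * Q j))
          ≈⟨ vanishing-rootProduct {c = c} {τ} c-van ρs 0
               (s≤s (ℕ.≤-trans (ℕ.≤-reflexive (ℕ.+-identityʳ _)) len)) ⟩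
        0#                                     ∎
        where
        rearrange : ∀ j → w j * Q j + w′ j * - Q j ≈ c j * (1# * Q j)
        rearrange j = trans (+-congˡ (*-congˡ (sym (-1*x≈-x (Q j)))))
          (solve 4 (λ w w′ n q → w :* q :+ w′ :* (n :* q) := (w :+ n :* w′) :* (con 1 :* q)) refl
            (w j) (w′ j) (- 1#) (Q j))
      w≈0 : ∀ j → w j ≈ 0#
      w≈0 j with f j Fin.≟ u
      ... | no  fj≢u = w-supp j fj≢u
      ... | yes fj≡u = *-cancel-≈0 (proj₂ (posQ j fj≡u))
        (nonneg-+≈0ˡ (wQ j) (w′Q j) (∑-nonneg-≈0 (λ j → nonneg-+ (wQ j) (w′Q j)) sum≈0 j))

    commonPoint⇒¬separated : ∀ {u v} → CommonPoint P f (⁅ u ⁆ ∪ ⁅ v ⁆) → ¬ Separated d (Occ u) (Occ v)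
    commonPoint⇒¬separated {u} {v} (x , inσ) (cs , len , b , onU , onV) = split b onU onV
      where
      inU : InConv P f u x
      inU = inσ u (x∈p∪q⁺ (inj₁ (x∈⁅x⁆ u)))
      inV : InConv P f v x
      inV = inσ v (x∈p∪q⁺ (inj₂ (x∈⁅x⁆ v)))
      ρs : List Carrier
      ρs = List.map cut cs
      len′ : length ρs ℕ.≤ d
      len′ = ≡.subst (ℕ._≤ d) (≡.sym (List.length-map cut cs)) len
      sign : ∀ {z b} → (∀ {q} → Occ z q → odd (rank cs q) ≡ b) →
             ∀ j → f j ≡ z → Pos (± (not b) (rootProduct ρs (node (π j))))
      sign onZ j fj≡z = ≡.subst (λ b → Pos (± (not b) (rootProduct ρs (node (π j)))))
                          (onZ (j , fj≡z , ≡.refl))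
                          (rootProduct-sign cs (π j))
      split : ∀ b → (∀ {q} → Occ u q → odd (rank cs q) ≡ b) →
              (∀ {q} → Occ v q → odd (rank cs q) ≡ not b) → ⊥
      -- Odd rank makes the polynomial negative on `u`, so the two letters exchange roles.
      split true  onU onV = separated⇒disjoint inV inU ρs len′ (sign onV) (sign onU)
      split false onU onV = separated⇒disjoint inU inV ρs len′ (sign onU) (sign onV)

-- From incidence graphs to the theorem

-- The pair has more than one element, so it is a face only as an edge, whose ends are `u` and `v`
-- in some order.
edge-adj : ∀ {n} (G : Graph n) {u v} → u ≢ v → graphComplex G (⁅ u ⁆ ∪ ⁅ v ⁆) → Graph.Adj G u v
edge-adj G {u} {v} u≢v (inj₁ size≤1) = contradiction size≤1 (ℕ.<⇒≱ size>1)
  where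
  size>1 : 1 < ∣ ⁅ u ⁆ ∪ ⁅ v ⁆ ∣
  size>1 = ≡.subst (_< ∣ ⁅ u ⁆ ∪ ⁅ v ⁆ ∣) (∣⁅x⁆∣≡1 u)
    (p⊂q⇒∣p∣<∣q∣ (p⊆p∪q ⁅ v ⁆ , v , x∈p∪q⁺ (inj₂ (x∈⁅x⁆ v)) , u≢v ∘ ≡.sym ∘ x∈⁅y⁆⇒x≡y u))
edge-adj G {u} {v} u≢v (inj₂ (u′ , v′ , adj , eq))
  with endpoint u (inj₁ (x∈⁅x⁆ u)) | endpoint v (inj₂ (x∈⁅x⁆ v))
  where
  endpoint : ∀ z → z Subset.∈ ⁅ u ⁆ ⊎ z Subset.∈ ⁅ v ⁆ → z ≡ u′ ⊎ z ≡ v′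
  endpoint z z∈ = Sum.map (x∈⁅y⁆⇒x≡y u′) (x∈⁅y⁆⇒x≡y v′)
    (x∈p∪q⁻ ⁅ u′ ⁆ ⁅ v′ ⁆ (≡.subst (z Subset.∈_) eq (x∈p∪q⁺ z∈)))
... | inj₁ ≡.refl | inj₁ v≡u    = contradiction (≡.sym v≡u) u≢v
... | inj₁ ≡.refl | inj₂ ≡.refl = adj
... | inj₂ ≡.refl | inj₁ ≡.refl = Graph.sym G adj
... | inj₂ ≡.refl | inj₂ v≡u    = contradiction (≡.sym v≡u) u≢v

open Alternation

incidenceGraph : ∀ n D → Graph (n ℕ.* D ℕ.+ 2 ℕ.^ n)
incidenceGraph n D = record
  { Adj    = λ u v → VAdj n D (splitAt (n ℕ.* D) u) (splitAt (n ℕ.* D) v)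
  ; sym    = λ {u} {v} → symmetric (splitAt (n ℕ.* D) u) (splitAt (n ℕ.* D) v)
  ; irrefl = λ {u} → irreflexive (splitAt (n ℕ.* D) u)
  }
  where
  symmetric : ∀ u v → VAdj n D u v → VAdj n D v u
  symmetric (inj₁ _) (inj₂ _) adj = adj
  symmetric (inj₂ _) (inj₁ _) adj = adj
  irreflexive : ∀ u → ¬ VAdj n D u u
  irreflexive (inj₁ _) ()
  irreflexive (inj₂ _) ()

module _ {ℓ ℓ₁ ℓ₂} (F : CompleteOrderedField ℓ ℓ₁ ℓ₂) where

  open Geometry F
  open MomentCurve F

  tverberg⇒weaklyTverberg : ∀ {n d} {Δ : Complex n} → Tverberg d Δ → WeaklyTverberg d Δ
  tverberg⇒weaklyTverberg (C , induced) = C , λ m P gp C≤m → m , id , id , induced m P gp C≤m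

  -- The property is applied to `C` points on the moment curve. The labelling of the selected
  -- subset, read along the curve, is a word of the kind excluded by `no-representation`.
  incidenceGraph-¬weaklyTverberg : ∀ {n D d} → 2 ℕ.+ d ≤ D →
    (2 ℕ.+ n ℕ.* D ℕ.* (n ℕ.* D ℕ.* d)) ℕ.^ (2 ℕ.+ d) < 2 ℕ.^ n →
    ¬ WeaklyTverberg d (graphComplex (incidenceGraph n D))
  incidenceGraph-¬weaklyTverberg {n} {D} {d} 2+d≤D large (C , induced)
    with induced C (momentPoints d C) (momentPoints-generalPosition d C) ℕ.≤-refl
  ... | m , h , h-inj , f , nerve =
    no-representation n D 2+d≤D large O O? O<C disjoint alternating⇒adj adj⇒alternating
    where
    G : Graph (n ℕ.* D ℕ.+ 2 ℕ.^ n)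
    G = incidenceGraph n D
    vertex : Vertex n D → Fin (n ℕ.* D ℕ.+ 2 ℕ.^ n)
    vertex = join (n ℕ.* D) (2 ℕ.^ n)
    split-vertex : ∀ v → splitAt (n ℕ.* D) (vertex v) ≡ v
    split-vertex = Fin.splitAt-join (n ℕ.* D) (2 ℕ.^ n)
    vertex-≢ : ∀ {u v} → u ≢ v → vertex u ≢ vertex v
    vertex-≢ {u} {v} u≢v eq =
      u≢v (≡.trans (≡.sym (split-vertex u)) (≡.trans (≡.cong (splitAt (n ℕ.* D)) eq) (split-vertex v)))
    adj⇒Adj : ∀ {u v} → VAdj n D u v → Graph.Adj G (vertex u) (vertex v)
    adj⇒Adj {u} {v} = ≡.subst₂ (VAdj n D) (≡.sym (split-vertex u)) (≡.sym (split-vertex v))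
    Adj⇒adj : ∀ {u v} → Graph.Adj G (vertex u) (vertex v) → VAdj n D u v
    Adj⇒adj {u} {v} = ≡.subst₂ (VAdj n D) (split-vertex u) (split-vertex v)
    π : Fin m → ℕ
    π = toℕ ∘ h
    O : Vertex n D → ℕ → Set
    O v = Occ {d} π f (vertex v)
    O? : ∀ v → Decidable (O v)
    O? v q = Fin.any? λ j → (f j Fin.≟ vertex v) ×-dec (π j ℕ.≟ q)
    O<C : ∀ v → Bounded C (O v)
    O<C v (j , _ , ≡.refl) = Fin.toℕ<n (h j)
    disjoint : ∀ {u v} → u ≢ v → Disjoint (O u) (O v)
    disjoint u≢v (j , fj≡u , πj≡q) (j′ , fj′≡v , πj′≡q) =
      vertex-≢ u≢v (≡.trans (≡.sym fj≡u) (≡.trans (≡.cong f j≡j′) fj′≡v))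
      where
      j≡j′ : j ≡ j′
      j≡j′ = h-inj (Fin.toℕ-injective (≡.trans πj≡q (≡.sym πj′≡q)))
    alternating⇒adj : ∀ {u v} → u ≢ v → Alternating (2 ℕ.+ d) (O u) (O v) → VAdj n D u v
    alternating⇒adj {u} {v} u≢v alt =
      Adj⇒adj {u} {v} (edge-adj G (vertex-≢ u≢v) (proj₁ (nerve _) (alternating⇒commonPoint {d} π f alt)))
    adj⇒≢ : ∀ {u v} → VAdj n D u v → u ≢ v
    adj⇒≢ {u} adj ≡.refl = Graph.irrefl G (adj⇒Adj {u} {u} adj)
    adj⇒alternating : ∀ {u v} → VAdj n D u v → Alternating (2 ℕ.+ d) (O u) (O v)
    adj⇒alternating {u} {v} adj
      with alternating⊎separated (O? u) (O? v) (O<C u) (O<C v) (disjoint (adj⇒≢ {u} {v} adj)) d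
    ... | inj₁ alt = alt
    ... | inj₂ sep = ⊥-elim (commonPoint⇒¬separated {d} π f
            (proj₂ (nerve _) (inj₂ (vertex u , vertex v , adj⇒Adj {u} {v} adj , ≡.refl))) sep)

theorem1p1 : (F : CompleteOrderedField 0ℓ 0ℓ 0ℓ) → let open Geometry F in
    ∀ (d : ℕ) → 1 ≤ d →
    ∃ λ (n : ℕ) → ∃ λ (G : Graph n) →
    ∀ (d' : ℕ) → 1 ≤ d' → d' ≤ d →
    ¬ WeaklyTverberg d' (graphComplex G) × ¬ Tverberg d' (graphComplex G)
theorem1p1 F d _ =
  -- `D` is fixed by the largest dimension, so that one graph serves every `d'`; by monotonicity the
  -- estimate for `D` implies the one for `d'`.
  let D = 2 ℕ.+ d
      n , large = exponential-dominates D (s≤s z≤n)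
  in n ℕ.* D ℕ.+ 2 ℕ.^ n , incidenceGraph n D , λ d' _ d'≤d →
    let bound = ℕ.≤-<-trans
          (ℕ.≤-trans
            (ℕ.^-monoˡ-≤ (2 ℕ.+ d') (ℕ.+-monoʳ-≤ 2 (ℕ.*-monoʳ-≤ (n ℕ.* D) (ℕ.*-monoʳ-≤ (n ℕ.* D)
              (ℕ.≤-trans d'≤d (ℕ.m≤n+m d 2))))))
            (ℕ.^-monoʳ-≤ (2 ℕ.+ n ℕ.* D ℕ.* (n ℕ.* D ℕ.* D)) (ℕ.+-monoʳ-≤ 2 d'≤d)))
          large
        ¬weakly = incidenceGraph-¬weaklyTverberg F {n} (ℕ.+-monoʳ-≤ 2 d'≤d) bound
    in ¬weakly , ¬weakly ∘ tverberg⇒weaklyTverberg F
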